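{- There is an absolute constant $c>0$ such that for all integers $o\ge 3$ and $r\ge 3$, $$\mathrm{CR}(o,r)\le \left(\frac{c\, r^3}{\log r}\right)^{o-2}.$$
   Context: An edge-coloring of the complete graph $K_n$ is any map $\chi:E(K_n)\to\omega$ (arbitrarily many colors allowed). A clique is rainbow if all of its edges receive pairwise distinct colors. A coloring of a clique $K_s$ is called orderable if there is an ordering $v_1,\dots,v_s$ of its vertices such that $\chi(v_iv_j)=\chi(v_iv_k)$ for all $1\le i<j<k\le s$ (edges with the same lower endpoint have the same color; edges with different lower endpoints may or may not share colors). $\mathrm{CR}(o,r)$ is the minimum $n$ such that every edge-coloring $\chi:E(K_n)\to\omega$ contains either a clique of order $o$ whose coloring is orderable or a rainbow clique of order $r$. -}

module Defs where

open import Data.Nat using (ℕ; _≤_; _*_; _^_; _∸_)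
open import Data.Fin using (Fin; _<_; _<?_)
open import Data.Product using (Σ; _×_; ∃)
open import Data.Sum using (_⊎_)
open import Relation.Binary.PropositionalEquality using (_≡_)
open import Relation.Nullary using (¬_; yes; no)
open import Function.Definitions using (Injective)

-- An edge-colouring of K_n with colours in ω = ℕ.  The colour of the edge
-- {u , v} with u < v is  χ u v ; values χ u v with u ≥ v are ignored.
Colouring : ℕ → Set
Colouring n = Fin n → Fin n → ℕ

col : ∀ {n} → Colouring n → Fin n → Fin n → ℕ
col χ u v with u <? v
... | yes _ = χ u v
... | no  _ = χ v u

-- A clique of order s in K_n, given together with an ordering v_0,…,v_{s-1}
-- of its vertices, is an injective map Fin s → Fin n.
Clique : ℕ → ℕ → Set
Clique n s = Σ (Fin s → Fin n) (Injective _≡_ _≡_)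

HasOrderable : ∀ {n} → Colouring n → ℕ → Set
HasOrderable {n} χ s = Σ (Clique n s) λ (f , _) →
  ∀ (i j k : Fin s) → i < j → j < k → col χ (f i) (f j) ≡ col χ (f i) (f k)
  where open import Data.Product using (_,_)

HasRainbow : ∀ {n} → Colouring n → ℕ → Set
HasRainbow {n} χ r = Σ (Clique n r) λ (g , _) →
  ∀ (a b c d : Fin r) → a < b → c < d →
    col χ (g a) (g b) ≡ col χ (g c) (g d) → (a ≡ c × b ≡ d)
  where open import Data.Product using (_,_)

-- The Ramsey property defining CR(o,r):  every colouring of K_n contains an
-- orderable K_o or a rainbow K_r.  CR(o,r) is the least n with this property.
CRProperty : ℕ → ℕ → ℕ → Set
CRProperty o r n = (χ : Colouring n) → HasOrderable χ o ⊎ HasRainbow χ r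

-- "CR(o,r) ≤ N"  ⇔  some n ≤ N has the property (the minimum is ≤ N).
CR≤ : ℕ → ℕ → ℕ → Set
CR≤ o r N = Σ ℕ λ n → n ≤ N × CRProperty o r n

{-# OPTIONS --safe #-}
module Submission where

-- Passing to monochromatic neighbourhoods, it suffices to find a rainbow K_r
-- when n = D m, D ≈ r³ / log r, and every colour occurs at most m times at each
-- vertex.  Suppose there is none.  Sample M = r^(1+ε) vertices x_1 , … , x_M
-- and let S be a uniformly random rainbow subset of the sample.  As S always
-- has at most r elements, a typical x_i belongs to S with probability at most
-- 1/L, where L = r^ε′.  For fixed S, the expected number of triples of S that
-- block a resampled x_i (by completing two equally coloured disjoint edges) is
-- O(r³ / D), so typically at most β, a small multiple of log r.  On the other
-- hand M is so small that typically no short cycle of coincidences passes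
-- through x_i; then, given the rest of S, the blocking triples occur
-- independently, and "at most β triples" having probability at least 1/2 forces
-- "no triple" to have probability at least a constant times 8^(- β).  When no
-- triple blocks x_i it can be added to S, so x_i lies in S more often than 1/L.
-- All probabilities are counts over Vec (Fin n) M and Vec Bool M.

open import Defs
open import Data.Nat
open import Data.Nat.Properties
open import Data.Nat.DivMod using (_/_; _%_; m≡m%n+[m/n]*n; m%n<n; m/n*n≤m)
open import Data.Nat.Induction using (<-rec)
open import Data.Nat.Logarithm using (⌊log₂_⌋; ⌊log₂⌊n/2⌋⌋≡⌊log₂n⌋∸1)
open import Data.Nat.Tactic.RingSolver using (solve-∀)
open import Algebra.Properties.CommutativeSemigroup *-commutativeSemigroup
  using () renaming (interchange to *-interchange; x∙yz≈y∙xz to *-exchange)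
open import Algebra.Properties.CommutativeSemigroup +-commutativeSemigroup
  using () renaming (interchange to +-interchange)
open import Data.Bool as Bool using (Bool; true; false; if_then_else_)
open import Data.Fin as Fin using (Fin; zero; suc; punchIn)
import Data.Fin.Properties as Fin
open import Data.List as List using (List; []; _∷_; length; allFin; concatMap; _++_)
open import Data.List.Properties using (length-tabulate)
open import Data.List.Membership.Propositional using (_∈_; lose)
open import Data.List.Membership.Propositional.Properties using (∈-allFin; ∈-map⁺; ∈-++⁺ˡ; ∈-++⁺ʳ)
open import Data.List.Relation.Unary.Any using (Any; here; there; any?; satisfied)
open import Data.Vec using (Vec; []; _∷_; lookup; _[_]≔_; tabulate; replicate)
open import Data.Vec.Properties using (lookup∘update; lookup∘update′; lookup∘tabulate; lookup-replicate; []≔-idempotent)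
open import Data.Product using (Σ; ∃; ∃₂; _×_; _,_; proj₁; proj₂)
open import Data.Sum using (_⊎_; inj₁; inj₂; [_,_]′)
open import Data.Unit using (⊤; tt)
open import Data.Empty using (⊥; ⊥-elim)
open import Function using (_∘_; id)
open import Function.Definitions using (Injective)
open import Relation.Nullary
open import Relation.Nullary.Decidable using (map′; dec-true; dec-false; decidable-stable)
open import Relation.Binary using (tri<; tri≈; tri>)
open import Relation.Binary.PropositionalEquality

-- Asking for fewer than one expected blocking triple would cost D ≈ r³. Tolerating about log r of
-- them loses only the factor 8^(- β), a small power of r, and this is what gains the logarithm. The
-- uniform distribution on rainbow subsets makes the loss comparable with occupancy, since adding i
-- maps sets to sets of equal weight. M is squeezed from both sides: occupancy needs M of order at
-- least L r with L of order 8^β, while cycles of b coincidences on 3 b positions need M^(3 b - 1)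
-- well below D^b. Independence is reached by fixing S outside one element of each blocking triple.
-- The estimate for a fixed part is linear in the counts involved, so that it can be averaged over S
-- although "at most β triples" may be unlikely for some of the fixed parts.

private variable
  X Y : Set

-- Finite sums and products

∑ : List X → (X → ℕ) → ℕ
∑ []       f = 0
∑ (a ∷ as) f = f a + ∑ as f

∑-mono : ∀ (as : List X) {f g : X → ℕ} → (∀ a → f a ≤ g a) → ∑ as f ≤ ∑ as g
∑-mono []       h = z≤n
∑-mono (a ∷ as) h = +-mono-≤ (h a) (∑-mono as h)

∑-cong : ∀ (as : List X) {f g : X → ℕ} → (∀ a → f a ≡ g a) → ∑ as f ≡ ∑ as g
∑-cong []       h = refl
∑-cong (a ∷ as) h = cong₂ _+_ (h a) (∑-cong as h)

∑-+ : ∀ (as : List X) (f g : X → ℕ) → ∑ as (λ a → f a + g a) ≡ ∑ as f + ∑ as g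
∑-+ []       f g = refl
∑-+ (a ∷ as) f g = trans (cong (f a + g a +_) (∑-+ as f g)) (+-interchange (f a) (g a) _ _)

∑-*ˡ : ∀ (as : List X) c (f : X → ℕ) → ∑ as (λ a → c * f a) ≡ c * ∑ as f
∑-*ˡ []       c f = sym (*-zeroʳ c)
∑-*ˡ (a ∷ as) c f = trans (cong (c * f a +_) (∑-*ˡ as c f)) (sym (*-distribˡ-+ c (f a) _))

∑-*ʳ : ∀ (as : List X) c (f : X → ℕ) → ∑ as (λ a → f a * c) ≡ ∑ as f * c
∑-*ʳ as c f = trans (∑-cong as (λ a → *-comm (f a) c)) (trans (∑-*ˡ as c f) (*-comm c _))

∑-const : ∀ (as : List X) c → ∑ as (λ _ → c) ≡ length as * c
∑-const []       c = refl
∑-const (a ∷ as) c = cong (c +_) (∑-const as c)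

∑-none : ∀ (as : List X) {f : X → ℕ} → (∀ a → f a ≡ 0) → ∑ as f ≡ 0
∑-none as h = trans (∑-cong as h) (trans (∑-const as 0) (*-zeroʳ (length as)))

∑-bound : ∀ (as : List X) {f : X → ℕ} {c} → (∀ a → f a ≤ c) → ∑ as f ≤ length as * c
∑-bound as {c = c} h = ≤-trans (∑-mono as h) (≤-reflexive (∑-const as c))

∑-swap : ∀ (as : List X) (bs : List Y) (f : X → Y → ℕ) →
         ∑ as (λ a → ∑ bs (f a)) ≡ ∑ bs (λ b → ∑ as (λ a → f a b))
∑-swap []       bs f = sym (trans (∑-const bs 0) (*-zeroʳ (length bs)))
∑-swap (a ∷ as) bs f = trans (cong (∑ bs (f a) +_) (∑-swap as bs f)) (sym (∑-+ bs (f a) _))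

∑-++ : ∀ (as bs : List X) (f : X → ℕ) → ∑ (as ++ bs) f ≡ ∑ as f + ∑ bs f
∑-++ []       bs f = refl
∑-++ (a ∷ as) bs f = trans (cong (f a +_) (∑-++ as bs f)) (sym (+-assoc (f a) _ _))

∑-map : ∀ (as : List X) (g : X → Y) (f : Y → ℕ) → ∑ (List.map g as) f ≡ ∑ as (f ∘ g)
∑-map []       g f = refl
∑-map (a ∷ as) g f = cong (f (g a) +_) (∑-map as g f)

∑-∈ : ∀ {as : List X} (f : X → ℕ) {a} → a ∈ as → f a ≤ ∑ as f
∑-∈ f (here refl) = m≤m+n _ _
∑-∈ f (there a∈)  = ≤-trans (∑-∈ f a∈) (m≤n+m _ _)

∑-<⇒∃ : ∀ (as : List X) {f g : X → ℕ} → ∑ as f < ∑ as g → ∃ λ a → f a < g a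
∑-<⇒∃ (a ∷ as) {f} {g} lt with f a <? g a
... | yes fa<ga = a , fa<ga
... | no  fa≮ga = ∑-<⇒∃ as (≰⇒> λ le → <⇒≱ lt (+-mono-≤ (≮⇒≥ fa≮ga) le))

∑-tabulate : ∀ M (g : Fin M → X) (f : X → ℕ) → ∑ (List.tabulate g) f ≡ ∑ (allFin M) (f ∘ g)
∑-tabulate zero    g f = refl
∑-tabulate (suc M) g f =
  cong (f (g zero) +_) (trans (∑-tabulate M (g ∘ suc) f) (sym (∑-tabulate M suc (f ∘ g))))

∑-allFin-suc : ∀ M (f : Fin (suc M) → ℕ) → ∑ (allFin (suc M)) f ≡ f zero + ∑ (allFin M) (f ∘ suc)
∑-allFin-suc M f = cong (f zero +_) (∑-tabulate M suc f)

length-allFin : ∀ M → length (allFin M) ≡ M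
length-allFin M = length-tabulate id

-- Uniform random vectors and redrawing of coordinates

vecs : List X → ∀ M → List (Vec X M)
vecs as zero    = [] ∷ []
vecs as (suc M) = concatMap (λ a → List.map (a ∷_) (vecs as M)) as

∑-concatMap : ∀ (as : List X) (g : X → List Y) (f : Y → ℕ) →
              ∑ (concatMap g as) f ≡ ∑ as (λ a → ∑ (g a) f)
∑-concatMap []       g f = refl
∑-concatMap (a ∷ as) g f = trans (∑-++ (g a) _ f) (cong (∑ (g a) f +_) (∑-concatMap as g f))

∑-vecs-suc : ∀ (as : List X) M (F : Vec X (suc M) → ℕ) →
             ∑ (vecs as (suc M)) F ≡ ∑ as (λ a → ∑ (vecs as M) (λ x → F (a ∷ x)))
∑-vecs-suc as M F = trans (∑-concatMap as _ F) (∑-cong as (λ a → ∑-map (vecs as M) (a ∷_) F))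

length-vecs : ∀ (as : List X) M → length (vecs as M) ≡ length as ^ M
length-vecs as zero    = refl
length-vecs as (suc M) = begin
  length (vecs as (suc M))                ≡⟨ *-identityʳ _ ⟨
  length (vecs as (suc M)) * 1            ≡⟨ ∑-const (vecs as (suc M)) 1 ⟨
  ∑ (vecs as (suc M)) (λ _ → 1)           ≡⟨ ∑-vecs-suc as M _ ⟩
  ∑ as (λ _ → ∑ (vecs as M) (λ _ → 1))    ≡⟨ ∑-const as _ ⟩
  length as * ∑ (vecs as M) (λ _ → 1)     ≡⟨ cong (length as *_) (trans (∑-const (vecs as M) 1) (*-identityʳ _)) ⟩
  length as * length (vecs as M)          ≡⟨ cong (length as *_) (length-vecs as M) ⟩
  length as * length as ^ M               ∎
  where open ≡-Reasoning

∈-concatMap : ∀ {as : List X} (g : X → List Y) {a b} → a ∈ as → b ∈ g a → b ∈ concatMap g as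
∈-concatMap g (here refl) b∈ = ∈-++⁺ˡ b∈
∈-concatMap {as = a ∷ as} g (there a∈) b∈ = ∈-++⁺ʳ (g a) (∈-concatMap g a∈ b∈)

∈-vecs : ∀ {as : List X} → (∀ a → a ∈ as) → ∀ {M} (x : Vec X M) → x ∈ vecs as M
∈-vecs all []      = here refl
∈-vecs all (a ∷ x) = ∈-concatMap _ (all a) (∈-map⁺ (a ∷_) (∈-vecs all x))

-- Redrawing one coordinate of a uniform vector leaves it uniform: every vector arises once for each
-- value of the forgotten coordinate. With labels as entries this redraws one sampled vertex; with
-- bits it pairs a set containing `i` with the one lacking it.
∑-resample : ∀ (as : List X) {M} (i : Fin M) (F : Vec X M → ℕ) →
             ∑ (vecs as M) (λ x → ∑ as (λ z → F (x [ i ]≔ z))) ≡ length as * ∑ (vecs as M) F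
∑-resample as {suc M} zero F = begin
  ∑ (vecs as (suc M)) (λ x → ∑ as (λ z → F (x [ zero ]≔ z)))   ≡⟨ ∑-vecs-suc as M _ ⟩
  ∑ as (λ _ → ∑ (vecs as M) (λ x → ∑ as (λ z → F (z ∷ x))))    ≡⟨ ∑-const as _ ⟩
  length as * ∑ (vecs as M) (λ x → ∑ as (λ z → F (z ∷ x)))     ≡⟨ cong (length as *_) (∑-swap (vecs as M) as _) ⟩
  length as * ∑ as (λ z → ∑ (vecs as M) (λ x → F (z ∷ x)))     ≡⟨ cong (length as *_) (∑-vecs-suc as M F) ⟨
  length as * ∑ (vecs as (suc M)) F                            ∎
  where open ≡-Reasoning
∑-resample as {suc M} (suc i) F = begin
  ∑ (vecs as (suc M)) (λ x → ∑ as (λ z → F (x [ suc i ]≔ z)))              ≡⟨ ∑-vecs-suc as M _ ⟩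
  ∑ as (λ a → ∑ (vecs as M) (λ x → ∑ as (λ z → F (a ∷ (x [ i ]≔ z)))))     ≡⟨ ∑-cong as (λ a → ∑-resample as i (λ x → F (a ∷ x))) ⟩
  ∑ as (λ a → length as * ∑ (vecs as M) (λ x → F (a ∷ x)))                 ≡⟨ ∑-*ˡ as (length as) _ ⟩
  length as * ∑ as (λ a → ∑ (vecs as M) (λ x → F (a ∷ x)))                 ≡⟨ cong (length as *_) (∑-vecs-suc as M F) ⟨
  length as * ∑ (vecs as (suc M)) F                                        ∎
  where open ≡-Reasoning

mix : ∀ {M} → Vec Bool M → Vec X M → Vec X M → Vec X M
mix []       []      []      = []
mix (u ∷ us) (s ∷ S) (r ∷ R) = (if u then r else s) ∷ mix us S R

lookup-mix : ∀ {M} U (S R : Vec X M) a →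
             lookup (mix U S R) a ≡ (if lookup U a then lookup R a else lookup S a)
lookup-mix (u ∷ us) (s ∷ S) (r ∷ R) zero    = refl
lookup-mix (u ∷ us) (s ∷ S) (r ∷ R) (suc a) = lookup-mix us S R a

-- For independent uniform `S` and `R` the mixture is again uniform. Summing over `R` with `S` fixed
-- therefore plays the role of conditioning on the coordinates outside `U`.
∑-mix : ∀ (as : List X) {M} (U : Vec Bool M) (F : Vec X M → ℕ) →
        ∑ (vecs as M) (λ S → ∑ (vecs as M) (λ R → F (mix U S R))) ≡ length as ^ M * ∑ (vecs as M) F
∑-mix as []      F = cong (_+ 0) (trans (+-identityʳ _) (sym (+-identityʳ _)))
∑-mix as {suc M} (u ∷ U) F = begin
  ∑ (vecs as (suc M)) (λ S → ∑ (vecs as (suc M)) (λ R → F (mix (u ∷ U) S R)))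
    ≡⟨ ∑-vecs-suc as M _ ⟩
  ∑ as (λ s → ∑ (vecs as M) (λ S → ∑ (vecs as (suc M)) (λ R → F (mix (u ∷ U) (s ∷ S) R))))
    ≡⟨ ∑-cong as (λ s → ∑-cong (vecs as M) (λ S → ∑-vecs-suc as M _)) ⟩
  ∑ as (λ s → ∑ (vecs as M) (λ S → ∑ as (λ r → ∑ (vecs as M) (λ R → F ((if u then r else s) ∷ mix U S R)))))
    ≡⟨ ∑-cong as (λ s → ∑-swap (vecs as M) as _) ⟩
  ∑ as (λ s → ∑ as (λ r → ∑ (vecs as M) (λ S → ∑ (vecs as M) (λ R → F ((if u then r else s) ∷ mix U S R)))))
    ≡⟨ ∑-cong as (λ s → ∑-cong as (λ r → ∑-mix as U (λ S → F ((if u then r else s) ∷ S)))) ⟩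
  ∑ as (λ s → ∑ as (λ r → length as ^ M * G (if u then r else s)))
    ≡⟨ choose u ⟩
  length as * ∑ as (λ s → length as ^ M * G s)
    ≡⟨ cong (length as *_) (∑-*ˡ as (length as ^ M) G) ⟩
  length as * (length as ^ M * ∑ as G)
    ≡⟨ *-assoc (length as) _ _ ⟨
  length as ^ suc M * ∑ as G
    ≡⟨ cong (length as ^ suc M *_) (∑-vecs-suc as M F) ⟨
  length as ^ suc M * ∑ (vecs as (suc M)) F ∎
  where
  open ≡-Reasoning
  G : _ → ℕ
  G s = ∑ (vecs as M) (λ S → F (s ∷ S))
  choose : ∀ u → ∑ as (λ s → ∑ as (λ r → length as ^ M * G (if u then r else s)))
               ≡ length as * ∑ as (λ s → length as ^ M * G s)
  choose true  = ∑-const as _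
  choose false = trans (∑-swap as as _) (∑-const as _)

-- Products over positions and independent random bits

∏ : ∀ M → (Fin M → ℕ) → ℕ
∏ zero    f = 1
∏ (suc M) f = f zero * ∏ M (f ∘ suc)

bools : List Bool
bools = true ∷ false ∷ []

∈-bools : ∀ b → b ∈ bools
∈-bools true  = here refl
∈-bools false = there (here refl)

∑-∏ : ∀ M (w : Fin M → Bool → ℕ) →
      ∑ (vecs bools M) (λ R → ∏ M (λ a → w a (lookup R a))) ≡ ∏ M (λ a → w a true + w a false)
∑-∏ zero    w = refl
∑-∏ (suc M) w = begin
  ∑ (vecs bools (suc M)) (λ R → ∏ (suc M) (λ a → w a (lookup R a)))  ≡⟨ ∑-vecs-suc bools M _ ⟩
  ∑ bools (λ b → ∑ (vecs bools M) (λ R → w zero b * rest R))         ≡⟨ ∑-cong bools (λ b → ∑-*ˡ (vecs bools M) (w zero b) rest) ⟩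
  ∑ bools (λ b → w zero b * ∑ (vecs bools M) rest)                   ≡⟨ ∑-*ʳ bools _ (w zero) ⟩
  (w zero true + (w zero false + 0)) * ∑ (vecs bools M) rest         ≡⟨ cong₂ _*_ (cong (w zero true +_) (+-identityʳ _)) (∑-∏ M (w ∘ suc)) ⟩
  (w zero true + w zero false) * ∏ M (λ a → w (suc a) true + w (suc a) false) ∎
  where
  open ≡-Reasoning
  rest : Vec Bool M → ℕ
  rest R = ∏ M (λ a → w (suc a) (lookup R a))

∏-mono : ∀ M {f g : Fin M → ℕ} → (∀ a → f a ≤ g a) → ∏ M f ≤ ∏ M g
∏-mono zero    h = ≤-refl
∏-mono (suc M) h = *-mono-≤ (h zero) (∏-mono M (h ∘ suc))

∏-* : ∀ M (f g : Fin M → ℕ) → ∏ M (λ a → f a * g a) ≡ ∏ M f * ∏ M g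
∏-* zero    f g = refl
∏-* (suc M) f g = trans (cong (f zero * g zero *_) (∏-* M _ _)) (*-interchange (f zero) (g zero) _ _)

∏-const : ∀ M c → ∏ M (λ _ → c) ≡ c ^ M
∏-const zero    c = refl
∏-const (suc M) c = cong (c *_) (∏-const M c)

∏-pos : ∀ M {f : Fin M → ℕ} → (∀ a → 1 ≤ f a) → 1 ≤ ∏ M f
∏-pos M h = ≤-trans (≤-reflexive (sym (trans (∏-const M 1) (^-zeroˡ M)))) (∏-mono M h)

ind : {P : Set} → Dec P → ℕ
ind (yes _) = 1
ind (no _)  = 0

module _ {P Q : Set} where

  ind-mono : (P → Q) → (p : Dec P) (q : Dec Q) → ind p ≤ ind q
  ind-mono h (yes p) (yes q) = ≤-refl
  ind-mono h (yes p) (no ¬q) = ⊥-elim (¬q (h p))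
  ind-mono h (no ¬p) q       = z≤n

  ind-* : (p : Dec P) (q : Dec Q) → ind (p ×-dec q) ≡ ind p * ind q
  ind-* (yes p) (yes q) = refl
  ind-* (yes p) (no ¬q) = refl
  ind-* (no ¬p) q       = refl

module _ {P : Set} where

  ind-yes : P → (p : Dec P) → ind p ≡ 1
  ind-yes h (yes p) = refl
  ind-yes h (no ¬p) = ⊥-elim (¬p h)

  ind-no : ¬ P → (p : Dec P) → ind p ≡ 0
  ind-no h (yes p) = ⊥-elim (h p)
  ind-no h (no ¬p) = refl

  ind-≤ : ∀ {k} → (p : Dec P) → (P → 1 ≤ k) → ind p ≤ k
  ind-≤ (yes p) h = h p
  ind-≤ (no ¬p) h = z≤n

  ind-zero : (p : Dec P) → ind p ≡ 0 → ¬ P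
  ind-zero (no ¬p) _ = ¬p

∏-ind : ∀ M {P : Set} {Q : Fin M → Set} (p : Dec P) (q : ∀ a → Dec (Q a)) →
        ((∀ a → Q a) → P) → ∏ M (λ a → ind (q a)) ≤ ind p
∏-ind zero    p q h = ≤-reflexive (sym (ind-yes (h λ ()) p))
∏-ind (suc M) p q h with q zero
... | yes q₀ = ≤-trans (≤-reflexive (*-identityˡ _))
                       (∏-ind M p (q ∘ suc) λ all → h λ { zero → q₀ ; (suc a) → all a })
... | no ¬q₀ = z≤n

ind-cong : {P Q : Set} → (P → Q) → (Q → P) → (p : Dec P) (q : Dec Q) → ind p ≡ ind q
ind-cong h h⁻¹ p q = ≤-antisym (ind-mono h p q) (ind-mono h⁻¹ q p)

-- Each `a` contributes a factor 2 to exactly one of the two terms on the right, so the sides are in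
-- fact equal. This writes 2 to the power of M minus the count as a product over positions, without
-- a subtraction.
∏-count : ∀ M {Q : Fin M → Set} (q : ∀ a → Dec (Q a)) →
          2 ^ M ≤ 2 ^ ∑ (allFin M) (λ a → ind (q a)) * ∏ M (λ a → 1 + ind (¬? (q a)))
∏-count zero    q = ≤-refl
∏-count (suc M) q with ∏-count M (q ∘ suc)
... | ih with q zero | ∑-allFin-suc M (λ a → ind (q a))
... | yes _ | eq = begin
  2 * 2 ^ M                 ≤⟨ *-monoʳ-≤ 2 ih ⟩
  2 * (2 ^ s * p)           ≡⟨ *-assoc 2 (2 ^ s) p ⟨
  2 ^ suc s * p             ≡⟨ cong₂ (λ u v → 2 ^ u * v) (sym eq) (sym (*-identityˡ p)) ⟩
  _                         ∎
  where
  open ≤-Reasoning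
  s = ∑ (allFin M) (λ a → ind (q (suc a)))
  p = ∏ M (λ a → 1 + ind (¬? (q (suc a))))
... | no _ | eq = begin
  2 * 2 ^ M                 ≤⟨ *-monoʳ-≤ 2 ih ⟩
  2 * (2 ^ s * p)           ≡⟨ *-exchange 2 (2 ^ s) p ⟩
  2 ^ s * (2 * p)           ≡⟨ cong (λ u → 2 ^ u * (2 * p)) (sym eq) ⟩
  _                         ∎
  where
  open ≤-Reasoning
  s = ∑ (allFin M) (λ a → ind (q (suc a)))
  p = ∏ M (λ a → 1 + ind (¬? (q (suc a))))

-- Colour clashes and short cycles in random labellings

module Clashes {n} (κ : Fin n → Fin n → ℕ) (κ-sym : ∀ u v → κ u v ≡ κ v u) (M : ℕ) where

  Labelling : Set
  Labelling = Vec (Fin n) M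

  colour : Labelling → Fin M → Fin M → ℕ
  colour x i j = κ (lookup x i) (lookup x j)

  record Clash (x : Labelling) (i j k l : Fin M) : Set where
    constructor clash
    field
      edge₁    : i ≢ j
      edge₂    : k ≢ l
      distinct : ¬ (i ≡ k × j ≡ l)
      crossed  : ¬ (i ≡ l × j ≡ k)
      same     : colour x i j ≡ colour x k l

  abstract
    Clash? : ∀ x i j k l → Dec (Clash x i j k l)
    Clash? x i j k l = map′
      (λ (a , b , c , d , e) → clash a b c d e)
      (λ (clash a b c d e) → a , b , c , d , e)
      (¬? (i Fin.≟ j) ×-dec ¬? (k Fin.≟ l) ×-dec ¬? (i Fin.≟ k ×-dec j Fin.≟ l)
        ×-dec ¬? (i Fin.≟ l ×-dec j Fin.≟ k) ×-dec colour x i j ≟ colour x k l)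

  module _ {x : Labelling} {i j k l : Fin M} where

    flipˡ : Clash x i j k l → Clash x j i k l
    flipˡ (clash a b c d e) = clash (a ∘ sym) b (λ (p , q) → d (q , p)) (λ (p , q) → c (q , p))
                                    (trans (κ-sym _ _) e)

    exchange : Clash x i j k l → Clash x k l i j
    exchange (clash a b c d e) = clash b a (λ (p , q) → c (sym p , sym q)) (λ (p , q) → d (sym q , sym p)) (sym e)

  flipʳ : ∀ {x i j k l} → Clash x i j k l → Clash x i j l k
  flipʳ = exchange ∘ flipˡ ∘ exchange

  -- The positions need not be distinct: two edges of equal colour sharing a
  -- vertex are covered by repeating that position.
  data Bad (x : Labelling) (i j k l : Fin M) : Set where
    ij∥kl : Clash x i j k l → Bad x i j k l
    ik∥jl : Clash x i k j l → Bad x i j k l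
    il∥jk : Clash x i l j k → Bad x i j k l

  abstract
    Bad? : ∀ x i j k l → Dec (Bad x i j k l)
    Bad? x i j k l = map′
      (λ { (inj₁ c) → ij∥kl c ; (inj₂ (inj₁ c)) → ik∥jl c ; (inj₂ (inj₂ c)) → il∥jk c })
      (λ { (ij∥kl c) → inj₁ c ; (ik∥jl c) → inj₂ (inj₁ c) ; (il∥jk c) → inj₂ (inj₂ c) })
      (Clash? x i j k l ⊎-dec Clash? x i k j l ⊎-dec Clash? x i l j k)

  module _ {x : Labelling} {i j k l : Fin M} where

    swap₁₂ : Bad x i j k l → Bad x j i k l
    swap₁₂ (ij∥kl c) = ij∥kl (flipˡ c)
    swap₁₂ (ik∥jl c) = il∥jk (exchange c)
    swap₁₂ (il∥jk c) = ik∥jl (exchange c)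

    swap₂₃ : Bad x i j k l → Bad x i k j l
    swap₂₃ (ij∥kl c) = ik∥jl c
    swap₂₃ (ik∥jl c) = ij∥kl c
    swap₂₃ (il∥jk c) = il∥jk (flipʳ c)

    swap₃₄ : Bad x i j k l → Bad x i j l k
    swap₃₄ (ij∥kl c) = ij∥kl (flipʳ c)
    swap₃₄ (ik∥jl c) = il∥jk c
    swap₃₄ (il∥jk c) = ik∥jl c

  module _ {x : Labelling} {i j k l : Fin M} where

    front₃ : Bad x i j k l → Bad x k i j l
    front₃ = swap₁₂ ∘ swap₂₃

    front₄ : Bad x i j k l → Bad x l i j k
    front₄ = swap₁₂ ∘ swap₂₃ ∘ swap₃₄

  -- At `a ≡ b` the pairings are `ii|aa` and twice `ia|ia`: a pair of loops, or an edge against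
  -- itself.
  Bad-iiab⇒≢ : ∀ {x i a b} → Bad x i i a b → a ≢ b
  Bad-iiab⇒≢ (ij∥kl (clash p _ _ _ _)) refl = p refl
  Bad-iiab⇒≢ (ik∥jl (clash _ _ p _ _)) refl = p (refl , refl)
  Bad-iiab⇒≢ (il∥jk (clash _ _ p _ _)) refl = p (refl , refl)

  ¬Bad-iii : ∀ {x i a} → ¬ Bad x i i i a
  ¬Bad-iii (ij∥kl (clash p _ _ _ _)) = p refl
  ¬Bad-iii (ik∥jl (clash p _ _ _ _)) = p refl
  ¬Bad-iii (il∥jk (clash _ p _ _ _)) = p refl

  Agree : Labelling → Labelling → Fin M → Set
  Agree x x′ i = lookup x i ≡ lookup x′ i

  module _ {x x′ : Labelling} {i j k l : Fin M} (i≈ : Agree x x′ i) (j≈ : Agree x x′ j) (k≈ : Agree x x′ k) (l≈ : Agree x x′ l) where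

    Bad-cong : Bad x i j k l → Bad x′ i j k l
    Bad-cong (ij∥kl (clash a b c d e)) = ij∥kl (clash a b c d (trans (sym (cong₂ κ i≈ j≈)) (trans e (cong₂ κ k≈ l≈))))
    Bad-cong (ik∥jl (clash a b c d e)) = ik∥jl (clash a b c d (trans (sym (cong₂ κ i≈ k≈)) (trans e (cong₂ κ j≈ l≈))))
    Bad-cong (il∥jk (clash a b c d e)) = il∥jk (clash a b c d (trans (sym (cong₂ κ i≈ l≈)) (trans e (cong₂ κ j≈ k≈))))

  agree : ∀ x {i j} z → j ≢ i → Agree (x [ i ]≔ z) x j
  agree x z j≢i = lookup∘update′ j≢i x z

  module _ {x : Labelling} {q i j k l : Fin M} {z : Fin n} (i≢q : i ≢ q) (j≢q : j ≢ q) (k≢q : k ≢ q) (l≢q : l ≢ q) where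

    Bad-resample : Bad (x [ q ]≔ z) i j k l → Bad x i j k l
    Bad-resample = Bad-cong (agree x z i≢q) (agree x z j≢q) (agree x z k≢q) (agree x z l≢q)

    Bad-resample⁻¹ : Bad x i j k l → Bad (x [ q ]≔ z) i j k l
    Bad-resample⁻¹ = Bad-cong (sym (agree x z i≢q)) (sym (agree x z j≢q)) (sym (agree x z k≢q)) (sym (agree x z l≢q))

  -- A triple {a , b , c} that blocks i from joining a rainbow set.
  record Link (x : Labelling) (i a b c : Fin M) : Set where
    constructor link
    field
      i≢a : i ≢ a
      i≢b : i ≢ b
      i≢c : i ≢ c
      a≢b : a ≢ b
      a≢c : a ≢ c
      b≢c : b ≢ c
      bad : Bad x i a b c

  abstract
    Link? : ∀ x i a b c → Dec (Link x i a b c)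
    Link? x i a b c = map′
      (λ (p , q , r , s , t , u , w) → link p q r s t u w)
      (λ (link p q r s t u w) → p , q , r , s , t , u , w)
      (¬? (i Fin.≟ a) ×-dec ¬? (i Fin.≟ b) ×-dec ¬? (i Fin.≟ c) ×-dec ¬? (a Fin.≟ b)
        ×-dec ¬? (a Fin.≟ c) ×-dec ¬? (b Fin.≟ c) ×-dec Bad? x i a b c)

  module _ {x : Labelling} {i a b c : Fin M} where

    Link-bac : Link x i a b c → Link x i b a c
    Link-bac (link p q r s t u w) = link q p r (s ∘ sym) u t (swap₂₃ w)

    Link-acb : Link x i a b c → Link x i a c b
    Link-acb (link p q r s t u w) = link p r q t s (u ∘ sym) (swap₃₄ w)

  module _ {x : Labelling} {i a b c : Fin M} where

    Link-bca : Link x i a b c → Link x i b c a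
    Link-bca = Link-acb ∘ Link-bac

    Link-cab : Link x i a b c → Link x i c a b
    Link-cab = Link-bac ∘ Link-acb

    Link-ciab : Link x i a b c → Link x c i a b
    Link-ciab (link p q r s t u w) = link (r ∘ sym) (t ∘ sym) (u ∘ sym) p q s (front₄ w)

  Link-cba : ∀ {x i a b c} → Link x i a b c → Link x i c b a
  Link-cba = Link-bca ∘ Link-acb

  Link-resample : ∀ {x i a b c q z} → q ≢ i → q ≢ a → q ≢ b → q ≢ c →
                  Link (x [ q ]≔ z) i a b c → Link x i a b c
  Link-resample q≢i q≢a q≢b q≢c (link p q r s t u w) = link p q r s t u
    (Bad-resample (q≢i ∘ sym) (q≢a ∘ sym) (q≢b ∘ sym) (q≢c ∘ sym) w)

  -- The short cycles through x_i (in the hypergraph of clashing sets) that a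
  -- sparse random labelling is unlikely to contain.
  Chord : Labelling → Fin M → Vec (Fin M) 2 → Set
  Chord x i (a ∷ b ∷ []) = i ≢ a × i ≢ b × a ≢ b × (Bad x i i a b ⊎ Bad x i a a b)

  TwoLinks : Labelling → Fin M → Vec (Fin M) 5 → Set
  TwoLinks x i (s ∷ b ∷ c ∷ d ∷ t ∷ []) = t ≢ b × t ≢ c × Link x i s b c × Link x i s d t

  -- A further bad quadruple through two positions of a link. Keeping `i` out of it lets the link be
  -- paid for by redrawing `i` alone.
  LinkChord : Labelling → Fin M → Vec (Fin M) 5 → Set
  LinkChord x i (a ∷ b ∷ c ∷ p ∷ q ∷ []) = p ≢ i × q ≢ i × Link x i a b c × Bad x a b p q

  -- Two links at `i` whose members `a` and `a′` are joined by a third bad quadruple. The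
  -- inequalities leave `c` in the first link only and `c′` outside the quadruple, so that `c`, then
  -- `c′`, then one of `a` and `a′` can be redrawn.
  LinkLinkChord : Labelling → Fin M → Vec (Fin M) 8 → Set
  LinkLinkChord x i (a ∷ b ∷ c ∷ a′ ∷ b′ ∷ c′ ∷ p ∷ q ∷ []) =
    a ≢ a′ × (c ≢ a′ × c ≢ b′ × c ≢ c′ × c ≢ p × c ≢ q) × (c′ ≢ a × c′ ≢ p × c′ ≢ q)
      × Link x i a b c × Link x i a′ b′ c′ × Bad x a a′ p q

  abstract
    Chord? : ∀ x i t → Dec (Chord x i t)
    Chord? x i (a ∷ b ∷ []) =
      ¬? (i Fin.≟ a) ×-dec ¬? (i Fin.≟ b) ×-dec ¬? (a Fin.≟ b) ×-dec (Bad? x i i a b ⊎-dec Bad? x i a a b)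

  abstract
    TwoLinks? : ∀ x i t → Dec (TwoLinks x i t)
    TwoLinks? x i (s ∷ b ∷ c ∷ d ∷ t ∷ []) =
      ¬? (t Fin.≟ b) ×-dec ¬? (t Fin.≟ c) ×-dec Link? x i s b c ×-dec Link? x i s d t

  abstract
    LinkChord? : ∀ x i t → Dec (LinkChord x i t)
    LinkChord? x i (a ∷ b ∷ c ∷ p ∷ q ∷ []) =
      ¬? (p Fin.≟ i) ×-dec ¬? (q Fin.≟ i) ×-dec Link? x i a b c ×-dec Bad? x a b p q

  abstract
    LinkLinkChord? : ∀ x i t → Dec (LinkLinkChord x i t)
    LinkLinkChord? x i (a ∷ b ∷ c ∷ a′ ∷ b′ ∷ c′ ∷ p ∷ q ∷ []) =
      ¬? (a Fin.≟ a′)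
        ×-dec (¬? (c Fin.≟ a′) ×-dec ¬? (c Fin.≟ b′) ×-dec ¬? (c Fin.≟ c′) ×-dec ¬? (c Fin.≟ p) ×-dec ¬? (c Fin.≟ q))
        ×-dec (¬? (c′ Fin.≟ a) ×-dec ¬? (c′ Fin.≟ p) ×-dec ¬? (c′ Fin.≟ q))
        ×-dec Link? x i a b c ×-dec Link? x i a′ b′ c′ ×-dec Bad? x a a′ p q

  vertices : List (Fin n)
  vertices = allFin n

  labellings : List Labelling
  labellings = vecs vertices M

  # : {P : Labelling → Set} → (∀ x → Dec (P x)) → ℕ
  # P? = ∑ labellings (λ x → ind (P? x))

  #all : ℕ
  #all = ∑ labellings (λ _ → 1)

  #-none : ∀ {P : Labelling → Set} (P? : ∀ x → Dec (P x)) → (∀ x → ¬ P x) → # P? ≡ 0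
  #-none P? none = ∑-none labellings (λ x → ind-no (none x) (P? x))

  #-mono : ∀ {P Q : Labelling → Set} (P? : ∀ x → Dec (P x)) (Q? : ∀ x → Dec (Q x)) →
           (∀ x → P x → Q x) → # P? ≤ # Q?
  #-mono P? Q? h = ∑-mono labellings (λ x → ind-mono (h x) (P? x) (Q? x))

  resample : ∀ (q : Fin M) (F : Labelling → ℕ) →
             ∑ labellings (λ x → ∑ vertices (λ z → F (x [ q ]≔ z))) ≡ n * ∑ labellings F
  resample q F = trans (∑-resample vertices q F) (cong (_* ∑ labellings F) (length-allFin n))

  -- Deferred decisions: with all labels but that of `q` fixed, `Q` is already determined and `R`
  -- accepts at most `k` of the `n` choices. Each use thus gains a factor `k / n`.
  eliminate : ∀ {P Q R : Labelling → Set} {k} (q : Fin M)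
              (P? : ∀ x → Dec (P x)) (Q? : ∀ x → Dec (Q x)) (R? : ∀ x → Dec (R x)) →
              (∀ x → P x → Q x × R x) → (∀ x z → Q (x [ q ]≔ z) → Q x) →
              (∀ x → ∑ vertices (λ z → ind (R? (x [ q ]≔ z))) ≤ k) →
              n * # P? ≤ k * # Q?
  eliminate {P} {Q} {R} {k} q P? Q? R? split Q-inv R-bound = begin
    n * # P?                                                            ≡⟨ resample q _ ⟨
    ∑ labellings (λ x → ∑ vertices (λ z → ind (P? (x [ q ]≔ z))))       ≤⟨ ∑-mono labellings (λ x → ∑-mono vertices (pointwise x)) ⟩
    ∑ labellings (λ x → ∑ vertices (λ z → ind (Q? x) * ind (R? (x [ q ]≔ z)))) ≡⟨ ∑-cong labellings (λ x → ∑-*ˡ vertices (ind (Q? x)) _) ⟩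
    ∑ labellings (λ x → ind (Q? x) * ∑ vertices (λ z → ind (R? (x [ q ]≔ z)))) ≤⟨ ∑-mono labellings (λ x → *-monoʳ-≤ (ind (Q? x)) (R-bound x)) ⟩
    ∑ labellings (λ x → ind (Q? x) * k)                                 ≡⟨ ∑-*ʳ labellings k _ ⟩
    # Q? * k                                                            ≡⟨ *-comm (# Q?) k ⟩
    k * # Q?                                                            ∎
    where
    open ≤-Reasoning
    pointwise : ∀ x z → ind (P? (x [ q ]≔ z)) ≤ ind (Q? x) * ind (R? (x [ q ]≔ z))
    pointwise x z = ≤-trans
      (ind-mono (λ p → let (qx , rx) = split _ p in Q-inv x z qx , rx) (P? _) (Q? x ×-dec R? (x [ q ]≔ z)))
      (≤-reflexive (ind-* (Q? x) (R? (x [ q ]≔ z))))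

  -- First-moment bounds for bad quadruples and short cycles

  module Sparse (m : ℕ) (degree : ∀ u k → ∑ (allFin n) (λ w → ind (κ u w ≟ k)) ≤ m) where

    degreeʳ : ∀ u k → ∑ vertices (λ w → ind (κ w u ≟ k)) ≤ m
    degreeʳ u k = ≤-trans (∑-mono vertices (λ w → ind-mono (trans (κ-sym u w)) (κ w u ≟ k) (κ u w ≟ k))) (degree u k)

    -- Each of the three pairings prescribes the colour of the edge from the new label `z` to a
    -- fixed vertex, which the degree hypothesis allows for at most `m` values. The positions `j`,
    -- `k`, `l` may coincide.
    Bad-free : ∀ {i j k l} → i ≢ j → i ≢ k → i ≢ l →
               ∀ x → ∑ vertices (λ z → ind (Bad? (x [ i ]≔ z) i j k l)) ≤ 3 * m
    Bad-free {i} {j} {k} {l} i≢j i≢k i≢l x = begin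
      ∑ vertices (λ z → ind (Bad? (x [ i ]≔ z) i j k l))
        ≤⟨ ∑-mono vertices (λ z → ind-≤ (Bad? (x [ i ]≔ z) i j k l) (pointwise z)) ⟩
      ∑ vertices (λ z → f z + (g z + h z))
        ≡⟨ trans (∑-+ vertices f _) (cong (∑ vertices f +_) (∑-+ vertices g h)) ⟩
      ∑ vertices f + (∑ vertices g + ∑ vertices h)
        ≤⟨ +-mono-≤ (degreeʳ _ _) (+-mono-≤ (degreeʳ _ _) (degreeʳ _ _)) ⟩
      m + (m + m)
        ≡⟨ cong (λ t → m + (m + t)) (+-identityʳ m) ⟨
      3 * m ∎
      where
      open ≤-Reasoning
      f g h : Fin n → ℕ
      f z = ind (κ z (lookup x j) ≟ colour x k l)
      g z = ind (κ z (lookup x k) ≟ colour x j l)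
      h z = ind (κ z (lookup x l) ≟ colour x j k)
      value : ∀ {z p q r} → i ≢ p → i ≢ q → i ≢ r → colour (x [ i ]≔ z) i p ≡ colour (x [ i ]≔ z) q r →
              κ z (lookup x p) ≡ colour x q r
      value {z} i≢p i≢q i≢r e =
        trans (sym (cong₂ κ (lookup∘update i x z) (agree x z (i≢p ∘ sym))))
              (trans e (cong₂ κ (agree x z (i≢q ∘ sym)) (agree x z (i≢r ∘ sym))))
      pointwise : ∀ z → Bad (x [ i ]≔ z) i j k l → 1 ≤ f z + (g z + h z)
      pointwise z (ij∥kl c) = ≤-trans (≤-reflexive (sym (ind-yes (value i≢j i≢k i≢l (Clash.same c)) (_ ≟ _))))
                                      (m≤m+n (f z) _)
      pointwise z (ik∥jl c) = ≤-trans (≤-reflexive (sym (ind-yes (value i≢k i≢j i≢l (Clash.same c)) (_ ≟ _))))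
                                      (≤-trans (m≤m+n (g z) (h z)) (m≤n+m _ (f z)))
      pointwise z (il∥jk c) = ≤-trans (≤-reflexive (sym (ind-yes (value i≢l i≢j i≢k (Clash.same c)) (_ ≟ _))))
                                      (≤-trans (m≤n+m (h z) (g z)) (m≤n+m _ (f z)))

    Link-free : ∀ {i a b c} → (x : Labelling) →
                ∑ vertices (λ z → ind (Link? (x [ i ]≔ z) i a b c)) ≤ 3 * m
    Link-free {i} {a} {b} {c} x = by-cases (i Fin.≟ a) (i Fin.≟ b) (i Fin.≟ c)
      where
      none : (∀ {z} → ¬ Link (x [ i ]≔ z) i a b c) → ∑ vertices (λ z → ind (Link? (x [ i ]≔ z) i a b c)) ≤ 3 * m
      none h = ≤-trans (≤-reflexive (∑-none vertices (λ z → ind-no h (Link? _ i a b c)))) z≤n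
      by-cases : Dec (i ≡ a) → Dec (i ≡ b) → Dec (i ≡ c) →
                 ∑ vertices (λ z → ind (Link? (x [ i ]≔ z) i a b c)) ≤ 3 * m
      by-cases (yes p) _ _ = none (λ l → Link.i≢a l p)
      by-cases _ (yes p) _ = none (λ l → Link.i≢b l p)
      by-cases _ _ (yes p) = none (λ l → Link.i≢c l p)
      by-cases (no i≢a) (no i≢b) (no i≢c) =
        ≤-trans (∑-mono vertices (λ z → ind-mono Link.bad (Link? _ i a b c) (Bad? _ i a b c))) (Bad-free i≢a i≢b i≢c x)

    codegree : ℕ
    codegree = 3 * m

    #Link : ∀ i a b c → n * # (λ x → Link? x i a b c) ≤ codegree * #all
    #Link i a b c = eliminate i (λ x → Link? x i a b c) (λ _ → yes tt) (λ x → Link? x i a b c)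
      (λ x l → tt , l) (λ _ _ _ → tt) Link-free

    Bad≢? : ∀ x a b p q → Dec (a ≢ b × Bad x a b p q)
    Bad≢? x a b p q = ¬? (a Fin.≟ b) ×-dec Bad? x a b p q

    -- A position among `a`, `b` that occurs only once in the quadruple is redrawn. If neither does,
    -- then `p` and `q` are `a` and `b` in some order, and such a quadruple is never bad.
    #Bad≢ : ∀ a b p q → n * # (λ x → Bad≢? x a b p q) ≤ codegree * #all
    #Bad≢ a b p q = by-cases (a Fin.≟ b) (a Fin.≟ p) (a Fin.≟ q) (b Fin.≟ p) (b Fin.≟ q)
      where
      none : (∀ x → ¬ (a ≢ b × Bad x a b p q)) → n * # (λ x → Bad≢? x a b p q) ≤ codegree * #all
      none h = ≤-trans (≤-reflexive (trans (cong (n *_) (#-none (λ x → Bad≢? x a b p q) h)) (*-zeroʳ n))) z≤n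
      free-a : a ≢ b → a ≢ p → a ≢ q → n * # (λ x → Bad≢? x a b p q) ≤ codegree * #all
      free-a a≢b a≢p a≢q = eliminate a (λ x → Bad≢? x a b p q) (λ _ → yes tt) (λ x → Bad? x a b p q)
        (λ x (_ , w) → tt , w) (λ _ _ _ → tt) (Bad-free a≢b a≢p a≢q)
      free-b : b ≢ a → b ≢ p → b ≢ q → n * # (λ x → Bad≢? x a b p q) ≤ codegree * #all
      free-b b≢a b≢p b≢q = eliminate b (λ x → Bad≢? x a b p q) (λ _ → yes tt) (λ x → Bad? x b a p q)
        (λ x (_ , w) → tt , swap₁₂ w) (λ _ _ _ → tt) (Bad-free b≢a b≢p b≢q)
      by-cases : Dec (a ≡ b) → Dec (a ≡ p) → Dec (a ≡ q) → Dec (b ≡ p) → Dec (b ≡ q) →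
                 n * # (λ x → Bad≢? x a b p q) ≤ codegree * #all
      by-cases (yes a≡b) _ _ _ _ = none (λ x (a≢b , _) → a≢b a≡b)
      by-cases (no a≢b) (no a≢p) (no a≢q) _ _ = free-a a≢b a≢p a≢q
      by-cases (no a≢b) _ _ (no b≢p) (no b≢q) = free-b (a≢b ∘ sym) b≢p b≢q
      by-cases (no a≢b) (yes refl) _ (yes b≡a) _ = ⊥-elim (a≢b (sym b≡a))
      by-cases (no a≢b) _ (yes refl) _ (yes b≡a) = ⊥-elim (a≢b (sym b≡a))
      by-cases (no a≢b) (yes refl) _ _ (yes refl) =
        none (λ x (_ , w) → Bad-iiab⇒≢ (swap₂₃ w) refl)
      by-cases (no a≢b) _ (yes refl) (yes refl) _ =
        none (λ x (_ , w) → Bad-iiab⇒≢ (swap₂₃ (swap₃₄ w)) refl)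

    #Chord : ∀ i t → n * # (λ x → Chord? x i t) ≤ (codegree + codegree) * #all
    #Chord i (a ∷ b ∷ []) = by-cases (i Fin.≟ b) (a Fin.≟ b)
      where
      none : (∀ x → ¬ Chord x i (a ∷ b ∷ [])) → n * # (λ x → Chord? x i (a ∷ b ∷ [])) ≤ (codegree + codegree) * #all
      none h = ≤-trans (≤-reflexive (trans (cong (n *_) (#-none (λ x → Chord? x i (a ∷ b ∷ [])) h)) (*-zeroʳ n))) z≤n
      either? : ∀ x → Dec (Bad x b i i a ⊎ Bad x b i a a)
      either? x = Bad? x b i i a ⊎-dec Bad? x b i a a
      ind-⊎ : ∀ x → ind (either? x) ≤ ind (Bad? x b i i a) + ind (Bad? x b i a a)
      ind-⊎ x = ind-≤ (either? x)
        [ (λ w → ≤-trans (≤-reflexive (sym (ind-yes w (Bad? x b i i a)))) (m≤m+n _ _))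
        , (λ w → ≤-trans (≤-reflexive (sym (ind-yes w (Bad? x b i a a)))) (m≤n+m _ _)) ]′
      bound : i ≢ b → a ≢ b → ∀ x → ∑ vertices (λ z → ind (either? (x [ b ]≔ z))) ≤ codegree + codegree
      bound i≢b a≢b x = ≤-trans (∑-mono vertices (λ z → ind-⊎ (x [ b ]≔ z)))
        (≤-trans (≤-reflexive (∑-+ vertices _ _))
          (+-mono-≤ (Bad-free (i≢b ∘ sym) (i≢b ∘ sym) (a≢b ∘ sym) x)
                    (Bad-free (i≢b ∘ sym) (a≢b ∘ sym) (a≢b ∘ sym) x)))
      by-cases : Dec (i ≡ b) → Dec (a ≡ b) → n * # (λ x → Chord? x i (a ∷ b ∷ [])) ≤ (codegree + codegree) * #all
      by-cases (yes i≡b) _ = none (λ x (_ , i≢b , _) → i≢b i≡b)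
      by-cases _ (yes a≡b) = none (λ x (_ , _ , a≢b , _) → a≢b a≡b)
      by-cases (no i≢b) (no a≢b) = eliminate b (λ x → Chord? x i (a ∷ b ∷ [])) (λ _ → yes tt) either?
        (λ x (_ , _ , _ , w) → tt , [ inj₁ ∘ front₄ , inj₂ ∘ front₄ ]′ w)
        (λ _ _ _ → tt) (bound i≢b a≢b)

    chain : ∀ {u v w} k k′ → n * u ≤ k * v → k′ * v ≤ w → k′ * (n * u) ≤ k * w
    chain {u} {v} {w} k k′ h h′ = begin
      k′ * (n * u) ≤⟨ *-monoʳ-≤ k′ h ⟩
      k′ * (k * v) ≡⟨ *-exchange k′ k v ⟩
      k * (k′ * v) ≤⟨ *-monoʳ-≤ k h′ ⟩
      k * w        ∎
      where
      open ≤-Reasoning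

    -- `t` occurs in the second link only and is redrawn first; what remains is the single link on
    -- `s`, `b`, `c`.
    #TwoLinks : ∀ i t → n * (n * # (λ x → TwoLinks? x i t)) ≤ codegree * (codegree * #all)
    #TwoLinks i (s ∷ b ∷ c ∷ d ∷ t ∷ []) = by-cases (t Fin.≟ i) (t Fin.≟ s) (t Fin.≟ b) (t Fin.≟ c)
      where
      ts = s ∷ b ∷ c ∷ d ∷ t ∷ []
      none : (∀ x → ¬ TwoLinks x i ts) → n * (n * # (λ x → TwoLinks? x i ts)) ≤ codegree * (codegree * #all)
      none h = ≤-trans (≤-reflexive (trans (cong (λ u → n * (n * u)) (#-none (λ x → TwoLinks? x i ts) h))
                                           (trans (cong (n *_) (*-zeroʳ n)) (*-zeroʳ n)))) z≤n
      by-cases : Dec (t ≡ i) → Dec (t ≡ s) → Dec (t ≡ b) → Dec (t ≡ c) →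
                 n * (n * # (λ x → TwoLinks? x i ts)) ≤ codegree * (codegree * #all)
      by-cases (yes t≡i) _ _ _ = none (λ x (_ , _ , _ , l) → Link.i≢c l (sym t≡i))
      by-cases _ (yes t≡s) _ _ = none (λ x (_ , _ , _ , l) → Link.a≢c l (sym t≡s))
      by-cases _ _ (yes t≡b) _ = none (λ x (t≢b , _) → t≢b t≡b)
      by-cases _ _ _ (yes t≡c) = none (λ x (_ , t≢c , _) → t≢c t≡c)
      by-cases (no t≢i) (no t≢s) (no t≢b) (no t≢c) =
        chain codegree n (eliminate t (λ x → TwoLinks? x i ts) (λ x → Link? x i s b c) (λ x → Link? x t i s d)
          (λ x (_ , _ , l , l′) → l , Link-ciab l′) (λ _ _ → Link-resample t≢i t≢s t≢b t≢c) Link-free)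
        (#Link i s b c)

    #LinkChord : ∀ i t → n * (n * # (λ x → LinkChord? x i t)) ≤ codegree * (codegree * #all)
    #LinkChord i (a ∷ b ∷ c ∷ p ∷ q ∷ []) =
      chain codegree n (eliminate i (λ x → LinkChord? x i (a ∷ b ∷ c ∷ p ∷ q ∷ [])) (λ x → Q? x) (λ x → Link? x i a b c)
        (λ x (p≢i , q≢i , l , w) → (p≢i , q≢i , Link.i≢a l , Link.i≢b l , Link.a≢b l , w) , l)
        (λ x z (p≢i , q≢i , i≢a , i≢b , a≢b , w) → p≢i , q≢i , i≢a , i≢b , a≢b ,
          Bad-resample (i≢a ∘ sym) (i≢b ∘ sym) p≢i q≢i w)
        Link-free)
      (≤-trans (*-monoʳ-≤ n (#-mono Q? (λ x → Bad≢? x a b p q) (λ x (_ , _ , _ , _ , w) → w))) (#Bad≢ a b p q))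
      where
      Q? : ∀ x → Dec (p ≢ i × q ≢ i × i ≢ a × i ≢ b × a ≢ b × Bad x a b p q)
      Q? x = ¬? (p Fin.≟ i) ×-dec ¬? (q Fin.≟ i) ×-dec ¬? (i Fin.≟ a) ×-dec ¬? (i Fin.≟ b) ×-dec Bad≢? x a b p q

    #LinkLinkChord : ∀ i t → n * (n * (n * # (λ x → LinkLinkChord? x i t))) ≤ codegree * (codegree * (codegree * #all))
    #LinkLinkChord i (a ∷ b ∷ c ∷ a′ ∷ b′ ∷ c′ ∷ p ∷ q ∷ []) = begin
      n * (n * (n * # P?))             ≤⟨ *-monoʳ-≤ n (*-monoʳ-≤ n first) ⟩
      n * (n * (codegree * # Q?))         ≡⟨ pull n codegree (# Q?) ⟩
      codegree * (n * (n * # Q?))         ≤⟨ *-monoʳ-≤ codegree (chain codegree n second (#Bad≢ a a′ p q)) ⟩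
      codegree * (codegree * (codegree * #all)) ∎
      where
      open ≤-Reasoning
      pull : ∀ u v w → u * (u * (v * w)) ≡ v * (u * (u * w))
      pull = solve-∀
      P? = λ x → LinkLinkChord? x i (a ∷ b ∷ c ∷ a′ ∷ b′ ∷ c′ ∷ p ∷ q ∷ [])
      Fixed : Set
      Fixed = (a ≢ c × c ≢ i) × (c ≢ a′ × c ≢ b′ × c ≢ c′ × c ≢ p × c ≢ q) × (c′ ≢ a × c′ ≢ a′ × c′ ≢ p × c′ ≢ q)
      Fixed? : Dec Fixed
      Fixed? = (¬? (a Fin.≟ c) ×-dec ¬? (c Fin.≟ i))
        ×-dec (¬? (c Fin.≟ a′) ×-dec ¬? (c Fin.≟ b′) ×-dec ¬? (c Fin.≟ c′) ×-dec ¬? (c Fin.≟ p) ×-dec ¬? (c Fin.≟ q))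
        ×-dec (¬? (c′ Fin.≟ a) ×-dec ¬? (c′ Fin.≟ a′) ×-dec ¬? (c′ Fin.≟ p) ×-dec ¬? (c′ Fin.≟ q))
      Q? : ∀ x → Dec (Fixed × Link x i a′ b′ c′ × (a ≢ a′ × Bad x a a′ p q))
      Q? x = Fixed? ×-dec Link? x i a′ b′ c′ ×-dec Bad≢? x a a′ p q
      first : n * # P? ≤ codegree * # Q?
      first = eliminate c P? Q? (λ x → Link? x c i a b)
        (λ { x (a≢a′ , c≢ , (c′≢a , c′≢p , c′≢q) , l , l′ , w) →
             (((Link.a≢c l , Link.i≢c l ∘ sym) , c≢ , (c′≢a , Link.a≢c l′ ∘ sym , c′≢p , c′≢q)) , l′ , a≢a′ , w) , Link-ciab l })
        (λ { x z (f@((a≢c , c≢i) , (c≢a′ , c≢b′ , c≢c′ , c≢p , c≢q) , _) , l′ , a≢a′ , w) →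
             f , Link-resample c≢i c≢a′ c≢b′ c≢c′ l′ , a≢a′ ,
             Bad-resample a≢c (c≢a′ ∘ sym) (c≢p ∘ sym) (c≢q ∘ sym) w })
        Link-free
      R? : ∀ x → Dec (Fixed × (a ≢ a′ × Bad x a a′ p q))
      R? x = Fixed? ×-dec Bad≢? x a a′ p q
      second : n * # Q? ≤ codegree * # (λ x → Bad≢? x a a′ p q)
      second = ≤-trans
        (eliminate c′ Q? R? (λ x → Link? x c′ i a′ b′)
          (λ { x (f , l′ , w) → (f , w) , Link-ciab l′ })
          (λ { x z (f@(_ , _ , (c′≢a , c′≢a′ , c′≢p , c′≢q)) , a≢a′ , w) →
               f , a≢a′ , Bad-resample (c′≢a ∘ sym) (c′≢a′ ∘ sym) (c′≢p ∘ sym) (c′≢q ∘ sym) w })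
          Link-free)
        (*-monoʳ-≤ codegree (#-mono R? (λ x → Bad≢? x a a′ p q) (λ x (_ , w) → w)))

-- Random rainbow position sets

-- Put u = 10 e C / (K A). The hypotheses give 10 f₁ ≤ u A and u³ A ≤ 1000 e³ B, so the claim
-- follows from u ≤ 1 + u³, with the cases u ≤ 1 and u > 1. Here `f₁`, `f₂`, `f₃` will count, for
-- one fixed part of `S`, the avoiding sets with few hits, all avoiding sets, and those without
-- hits; a bound linear in them can be summed over the fixed parts.
dichotomy : ∀ {A B C K e f₁ f₂ f₃} → 1 ≤ K → 1 ≤ A → 1 ≤ C →
            A * (C * C * C) ≤ B * (K * A * (K * A) * (K * A)) →
            K * f₁ ≤ e * C → A ≤ f₂ → B ≤ f₃ →
            10 * f₁ ≤ f₂ + e * e * e * 1000 * f₃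
dichotomy {A} {B} {C} {K} {e} {f₁} {f₂} {f₃} 1≤K 1≤A 1≤C cubes h₁ h₂ h₃ with 10 * (e * C) ≤? K * A
... | yes small = ≤-trans (*-cancelˡ-≤ K {{>-nonZero 1≤K}} (begin
    K * (10 * f₁)  ≡⟨ assoc K f₁ ⟩
    10 * (K * f₁)  ≤⟨ *-monoʳ-≤ 10 h₁ ⟩
    10 * (e * C)   ≤⟨ small ⟩
    K * A          ≤⟨ *-monoʳ-≤ K h₂ ⟩
    K * f₂         ∎)) (m≤m+n f₂ _)
  where
  open ≤-Reasoning
  assoc : ∀ K f → K * (10 * f) ≡ 10 * (K * f)
  assoc = solve-∀
... | no large = ≤-trans (*-cancelˡ-≤ K {{>-nonZero 1≤K}} (begin
    K * (10 * f₁)                   ≡⟨ assoc K f₁ ⟩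
    10 * (K * f₁)                   ≤⟨ *-monoʳ-≤ 10 h₁ ⟩
    10 * (e * C)                    ≤⟨ *-monoʳ-≤ 10 (*-monoʳ-≤ e C-bound) ⟩
    10 * (e * (B * K * (100 * (e * e)))) ≡⟨ collect e B K ⟩
    K * (e * e * e * 1000 * B)    ≤⟨ *-monoʳ-≤ K (*-monoʳ-≤ (e * e * e * 1000) h₃) ⟩
    K * (e * e * e * 1000 * f₃)   ∎)) (m≤n+m _ f₂)
  where
  open ≤-Reasoning
  assoc : ∀ K f → K * (10 * f) ≡ 10 * (K * f)
  assoc = solve-∀
  collect : ∀ e B K → 10 * (e * (B * K * (100 * (e * e)))) ≡ K * (e * e * e * 1000 * B)
  collect = solve-∀
  KA≤ : K * A ≤ 10 * (e * C)
  KA≤ = <⇒≤ (≰⇒> large)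
  left : ∀ A C → A * (C * C * C) ≡ A * C * C * C
  left = solve-∀
  right : ∀ A B C K e → B * (K * A * (10 * (e * C)) * (10 * (e * C))) ≡ A * C * C * (B * K * (100 * (e * e)))
  right = solve-∀
  C-bound : C ≤ B * K * (100 * (e * e))
  C-bound = *-cancelˡ-≤ (A * C * C) {{>-nonZero (*-mono-≤ (*-mono-≤ 1≤A 1≤C) 1≤C)}} (begin
    A * C * C * C                                  ≡⟨ left A C ⟨
    A * (C * C * C)                                ≤⟨ cubes ⟩
    B * (K * A * (K * A) * (K * A))                ≤⟨ *-monoʳ-≤ B (*-mono-≤ (*-monoʳ-≤ (K * A) KA≤) KA≤) ⟩
    B * (K * A * (10 * (e * C)) * (10 * (e * C)))  ≡⟨ right A B C K e ⟩
    A * C * C * (B * K * (100 * (e * e)))          ∎)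

module Sets {n} (κ : Fin n → Fin n → ℕ) (κ-sym : ∀ u v → κ u v ≡ κ v u) (M : ℕ) where

  open Clashes κ κ-sym M public

  Positions : Set
  Positions = Vec Bool M

  subsets : List Positions
  subsets = vecs bools M

  In : Positions → Fin M → Set
  In S a = lookup S a ≡ true

  In? : ∀ S a → Dec (In S a)
  In? S a = lookup S a Bool.≟ true

  Valid : Labelling → Positions → Set
  Valid x S = ∀ j k l p → In S j → In S k → In S l → In S p → ¬ Bad x j k l p

  Avoiding : Labelling → Fin M → Positions → Set
  Avoiding x i S = Valid x S × ¬ In S i

  -- Each link is represented by its least element only; resampling just these
  -- elements keeps them independent.
  Top : Labelling → Fin M → Fin M → Set
  Top x i a = ∃₂ λ b c → a Fin.< b × a Fin.< c × Link x i a b c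

  Completes : Labelling → Fin M → Positions → Fin M → Set
  Completes x i S a = ∃₂ λ b c → In S b × In S c × a Fin.< b × a Fin.< c × Link x i a b c

  Hit : Labelling → Fin M → Positions → Fin M → Set
  Hit x i S a = In S a × Completes x i S a

  abstract
    Valid? : ∀ x S → Dec (Valid x S)
    Valid? x S = Fin.all? λ j → Fin.all? λ k → Fin.all? λ l → Fin.all? λ p →
      In? S j →-dec In? S k →-dec In? S l →-dec In? S p →-dec ¬? (Bad? x j k l p)

    Avoiding? : ∀ x i S → Dec (Avoiding x i S)
    Avoiding? x i S = Valid? x S ×-dec ¬? (In? S i)

    Top? : ∀ x i a → Dec (Top x i a)
    Top? x i a = Fin.any? λ b → Fin.any? λ c → a Fin.<? b ×-dec a Fin.<? c ×-dec Link? x i a b c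

    Completes? : ∀ x i S a → Dec (Completes x i S a)
    Completes? x i S a = Fin.any? λ b → Fin.any? λ c →
      In? S b ×-dec In? S c ×-dec a Fin.<? b ×-dec a Fin.<? c ×-dec Link? x i a b c

    Hit? : ∀ x i S a → Dec (Hit x i S a)
    Hit? x i S a = In? S a ×-dec Completes? x i S a

  -- Counts the least elements of blocking triples. It vanishes exactly when no triple inside `S`
  -- blocks `i`, and never exceeds the number of such triples.
  hits : Labelling → Fin M → Positions → ℕ
  hits x i S = ∑ (allFin M) (λ a → ind (Hit? x i S a))

  Valid-⊆ : ∀ {x} S S′ → (∀ a → In S a → In S′ a) → Valid x S′ → Valid x S
  Valid-⊆ S S′ sub v j k l p j∈ k∈ l∈ p∈ = v j k l p (sub j j∈) (sub k k∈) (sub l l∈) (sub p p∈)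

  In-insert : ∀ S {a e} → In (S [ a ]≔ true) e → e ≢ a → In S e
  In-insert S e∈ e≢a = trans (sym (lookup∘update′ e≢a S true)) e∈

  record Clean (x : Labelling) (i : Fin M) : Set where
    field
      noChord         : ∀ t → ¬ Chord x i t
      noTwoLinks      : ∀ t → ¬ TwoLinks x i t
      noLinkChord     : ∀ t → ¬ LinkChord x i t
      noLinkLinkChord : ∀ t → ¬ LinkLinkChord x i t

  -- With t = eC / KA the claim is t ≤ 1/10 + 100 t³, which holds for every t.
  module Local (x : Labelling) (i : Fin M) (clean : Clean x i) where

    open Clean clean

    -- Distinct links at `i` are disjoint; `s` is the common position and `a` shows that they
    -- differ.
    links-disjoint : ∀ {s d e f a} → a ≢ d → a ≢ e → Link x i s d e → ¬ Link x i s f a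
    links-disjoint a≢d a≢e l l′ = noTwoLinks _ (a≢d , a≢e , l , l′)

    -- A link with least element `b` would meet the given link in `b` but miss `a`, which is
    -- smaller, against disjointness. Hence each link contains exactly one top.
    ¬Top-second : ∀ {a b c} → Link x i a b c → a Fin.< b → ¬ Top x i b
    ¬Top-second l a<b (d , e , b<d , b<e , l′) =
      links-disjoint (Fin.<⇒≢ (Fin.<-trans a<b b<d)) (Fin.<⇒≢ (Fin.<-trans a<b b<e)) l′ (Link-bca l)

    module _ {a b c a′ b′ c′ : Fin M} (a<b : a Fin.< b) (a<c : a Fin.< c) (l : Link x i a b c)
             (a′<b′ : a′ Fin.< b′) (a′<c′ : a′ Fin.< c′) (l′ : Link x i a′ b′ c′) (a<a′ : a Fin.< a′) where

      -- Otherwise the two links and the quadruple form a `LinkLinkChord`. The order `a < a′` keeps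
      -- `a` out of the second link; then disjointness keeps `c` out of it, and `noLinkChord` keeps
      -- `c` and `c′` away from `p` and `q`.
      tops-separated-< : ∀ {p q} → p ≢ i → q ≢ i → ¬ Bad x a a′ p q
      tops-separated-< {p} {q} p≢i q≢i w = noLinkLinkChord (a ∷ b ∷ c ∷ a′ ∷ b′ ∷ c′ ∷ p ∷ q ∷ [])
        ( a≢a′ , (c≢a′ , c≢b′ , c≢c′ , c≢p , c≢q) , (a≢c′ ∘ sym , c′≢p , c′≢q) , l , l′ , w )
        where
        a≢a′ : a ≢ a′
        a≢a′ = Fin.<⇒≢ a<a′
        a≢b′ : a ≢ b′
        a≢b′ = Fin.<⇒≢ (Fin.<-trans a<a′ a′<b′)
        a≢c′ : a ≢ c′
        a≢c′ = Fin.<⇒≢ (Fin.<-trans a<a′ a′<c′)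
        c≢a′ : c ≢ a′
        c≢a′ refl = ¬Top-second (Link-acb l) a<c (b′ , c′ , a′<b′ , a′<c′ , l′)
        c≢b′ : c ≢ b′
        c≢b′ refl = links-disjoint a≢a′ a≢c′ (Link-bac l′) (Link-cba l)
        c≢c′ : c ≢ c′
        c≢c′ refl = links-disjoint a≢a′ a≢b′ (Link-cab l′) (Link-cba l)
        c≢p : c ≢ p
        c≢p refl = noLinkChord (a ∷ c ∷ b ∷ a′ ∷ q ∷ []) (Link.i≢a l′ ∘ sym , q≢i , Link-acb l , swap₂₃ w)
        c≢q : c ≢ q
        c≢q refl = noLinkChord (a ∷ c ∷ b ∷ a′ ∷ p ∷ []) (Link.i≢a l′ ∘ sym , p≢i , Link-acb l , swap₂₃ (swap₃₄ w))
        c′≢p : c′ ≢ p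
        c′≢p refl = noLinkChord (a′ ∷ c′ ∷ b′ ∷ a ∷ q ∷ [])
          (Link.i≢a l ∘ sym , q≢i , Link-acb l′ , swap₂₃ (swap₁₂ w))
        c′≢q : c′ ≢ q
        c′≢q refl = noLinkChord (a′ ∷ c′ ∷ b′ ∷ a ∷ p ∷ [])
          (Link.i≢a l ∘ sym , p≢i , Link-acb l′ , swap₂₃ (swap₁₂ (swap₃₄ w)))

    tops-separated : ∀ {a a′ p q} → Top x i a → Top x i a′ → p ≢ i → q ≢ i → Bad x a a′ p q → a′ ≡ a
    tops-separated {a} {a′} (b , c , a<b , a<c , l) (b′ , c′ , a′<b′ , a′<c′ , l′) p≢i q≢i w
      with Fin.<-cmp a a′
    ... | tri≈ _ a≡a′ _ = sym a≡a′
    ... | tri< a<a′ _ _ = ⊥-elim (tops-separated-< a<b a<c l a′<b′ a′<c′ l′ a<a′ p≢i q≢i w)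
    ... | tri> _ _ a′<a = ⊥-elim (tops-separated-< a′<b′ a′<c′ l′ a<b a<c l a′<a p≢i q≢i (swap₁₂ w))

    ¬Top-i : ¬ Top x i i
    ¬Top-i (_ , _ , _ , _ , l) = Link.i≢a l refl

    -- A bad quadruple created by `i` contains `i`. If its other positions are three distinct ones,
    -- they form a link inside `S` and its least element is a hit; any repetition makes it a chord
    -- or a degenerate quadruple that is never bad.
    extend : ∀ {S} → Avoiding x i S → hits x i S ≡ 0 → Valid x (S [ i ]≔ true)
    extend {S} (valid , i∉S) no-hits j k l p j∈ k∈ l∈ p∈ w =
      by-cases (j Fin.≟ i) (k Fin.≟ i) (l Fin.≟ i) (p Fin.≟ i)
      where
      S⁺ = S [ i ]≔ true
      no-hit : ∀ a → ¬ Hit x i S a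
      no-hit a = ind-zero (Hit? x i S a)
        (n≤0⇒n≡0 (≤-trans (∑-∈ (λ a → ind (Hit? x i S a)) (∈-allFin a)) (≤-reflexive no-hits)))
      least : ∀ {a b c} → In S a → In S b → In S c → Link x i a b c → a Fin.< b → a Fin.< c → ⊥
      least a∈ b∈ c∈ lk a<b a<c = no-hit _ (a∈ , _ , _ , b∈ , c∈ , a<b , a<c , lk)
      no-link : ∀ {a b c} → In S a → In S b → In S c → ¬ Link x i a b c
      no-link {a} {b} {c} a∈ b∈ c∈ lk with Fin.<-cmp a b | Fin.<-cmp a c | Fin.<-cmp b c
      ... | tri≈ _ e _ | _ | _ = Link.a≢b lk e
      ... | _ | tri≈ _ e _ | _ = Link.a≢c lk e
      ... | _ | _ | tri≈ _ e _ = Link.b≢c lk e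
      ... | tri< a<b _ _ | tri< a<c _ _ | _ = least a∈ b∈ c∈ lk a<b a<c
      ... | tri> _ _ b<a | _ | tri< b<c _ _ = least b∈ a∈ c∈ (Link-bac lk) b<a b<c
      ... | _ | tri> _ _ c<a | tri> _ _ c<b = least c∈ b∈ a∈ (Link-cba lk) c<b c<a
      ... | tri< a<b _ _ | tri> _ _ c<a | tri< b<c _ _ = Fin.<-asym (Fin.<-trans a<b b<c) c<a
      ... | tri> _ _ b<a | tri< a<c _ _ | tri> _ _ c<b = Fin.<-asym (Fin.<-trans b<a a<c) c<b
      chord₁ : ∀ {a b} → a ≢ i → b ≢ i → ¬ Bad x i i a b
      chord₁ {a} {b} a≢i b≢i w′ = noChord (a ∷ b ∷ []) (a≢i ∘ sym , b≢i ∘ sym , Bad-iiab⇒≢ w′ , inj₁ w′)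
      chord₂ : ∀ {a b} → a ≢ i → b ≢ i → ¬ Bad x i a a b
      chord₂ {a} {b} a≢i b≢i w′ with a Fin.≟ b
      ... | yes refl = ¬Bad-iii (swap₃₄ (swap₂₃ (swap₁₂ w′)))
      ... | no a≢b   = noChord (a ∷ b ∷ []) (a≢i ∘ sym , b≢i ∘ sym , a≢b , inj₂ w′)
      through-i-once : ∀ {a b c} → In S⁺ a → In S⁺ b → In S⁺ c → a ≢ i → b ≢ i → c ≢ i → ¬ Bad x i a b c
      through-i-once {a} {b} {c} a∈ b∈ c∈ a≢i b≢i c≢i w′ with a Fin.≟ b | a Fin.≟ c | b Fin.≟ c
      ... | yes refl | _ | _ = chord₂ a≢i c≢i w′
      ... | _ | yes refl | _ = chord₂ a≢i b≢i (swap₃₄ w′)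
      ... | _ | _ | yes refl = chord₂ b≢i a≢i (swap₃₄ (swap₂₃ w′))
      ... | no a≢b | no a≢c | no b≢c =
        no-link (In-insert S a∈ a≢i) (In-insert S b∈ b≢i) (In-insert S c∈ c≢i)
                (link (a≢i ∘ sym) (b≢i ∘ sym) (c≢i ∘ sym) a≢b a≢c b≢c w′)
      through-i-twice : ∀ {a b} → ¬ Bad x i i a b
      through-i-twice {a} {b} w′ with a Fin.≟ i | b Fin.≟ i
      ... | yes refl | _        = ¬Bad-iii w′
      ... | no _     | yes refl = ¬Bad-iii (swap₃₄ w′)
      ... | no a≢i   | no b≢i   = chord₁ a≢i b≢i w′
      through-i : ∀ {a b c} → In S⁺ a → In S⁺ b → In S⁺ c → ¬ Bad x i a b c
      through-i {a} {b} {c} a∈ b∈ c∈ w′ with a Fin.≟ i | b Fin.≟ i | c Fin.≟ i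
      ... | yes refl | _ | _ = through-i-twice w′
      ... | _ | yes refl | _ = through-i-twice (swap₂₃ w′)
      ... | _ | _ | yes refl = through-i-twice (swap₂₃ (swap₃₄ w′))
      ... | no a≢i | no b≢i | no c≢i = through-i-once a∈ b∈ c∈ a≢i b≢i c≢i w′
      by-cases : Dec (j ≡ i) → Dec (k ≡ i) → Dec (l ≡ i) → Dec (p ≡ i) → ⊥
      by-cases (yes refl) _ _ _ = through-i k∈ l∈ p∈ w
      by-cases _ (yes refl) _ _ = through-i j∈ l∈ p∈ (swap₁₂ w)
      by-cases _ _ (yes refl) _ = through-i j∈ k∈ p∈ (front₃ w)
      by-cases _ _ _ (yes refl) = through-i j∈ k∈ l∈ (front₄ w)
      by-cases (no j≢i) (no k≢i) (no l≢i) (no p≢i) =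
        valid j k l p (In-insert S j∈ j≢i) (In-insert S k∈ k≢i) (In-insert S l∈ l≢i) (In-insert S p∈ p≢i) w

    tops : Positions
    tops = tabulate (λ a → does (Top? x i a))

    resampled : Positions → Positions → Positions
    resampled S R = mix tops S R

    lookup-top : ∀ S R {a} → Top x i a → lookup (resampled S R) a ≡ lookup R a
    lookup-top S R {a} t = trans (lookup-mix tops S R a)
      (cong (λ b → if b then lookup R a else lookup S a)
            (trans (lookup∘tabulate _ a) (dec-true (Top? x i a) t)))

    lookup-rest : ∀ S R {a} → ¬ Top x i a → lookup (resampled S R) a ≡ lookup S a
    lookup-rest S R {a} ¬t = trans (lookup-mix tops S R a)
      (cong (λ b → if b then lookup R a else lookup S a)
            (trans (lookup∘tabulate _ a) (dec-false (Top? x i a) ¬t)))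

    -- Given the part O of a random admissible set off the tops, its part R on
    -- the tops is uniform among all subsets of the available tops.
    module Conditional (S : Positions) where

      O : Positions
      O = resampled S (replicate M false)

      ∉O : ∀ {a} → Top x i a → ¬ In O a
      ∉O {a} t a∈ with trans (sym (lookup-replicate a false)) (trans (sym (lookup-top S _ t)) a∈)
      ... | ()

      O⊆ : ∀ R a → In O a → In (resampled S R) a
      O⊆ R a a∈ with Top? x i a
      ... | yes t = ⊥-elim (∉O t a∈)
      ... | no ¬t = trans (lookup-rest S R ¬t) (trans (sym (lookup-rest S _ ¬t)) a∈)

      ⊆O : ∀ R {a} → ¬ Top x i a → In (resampled S R) a → In O a
      ⊆O R ¬t a∈ = trans (lookup-rest S _ ¬t) (trans (sym (lookup-rest S R ¬t)) a∈)

      -- Vacuous off the tops, where `resampled` ignores the bits of `R`; such bits stay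
      -- unconstrained and cancel in the comparison of the totals.
      Available : Fin M → Set
      Available a = Top x i a → Valid x (O [ a ]≔ true)

      Free : Fin M → Bool → Set
      Free a true  = Available a
      Free a false = ⊤

      Free? : ∀ a r → Dec (Free a r)
      Free? a true  = Top? x i a →-dec Valid? x (O [ a ]≔ true)
      Free? a false = yes tt

      NoHit : Fin M → Bool → Set
      NoHit a true  = ¬ Completes x i O a
      NoHit a false = ⊤

      NoHit? : ∀ a r → Dec (NoHit a r)
      NoHit? a true  = ¬? (Completes? x i O a)
      NoHit? a false = yes tt

      module _ (R : Positions) where

        mixed : Positions
        mixed = resampled S R

        i-mixed : ¬ In O i → ¬ In mixed i
        i-mixed i∉ i∈ = i∉ (⊆O R ¬Top-i i∈)

        avoiding-O : Avoiding x i mixed → Avoiding x i O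
        avoiding-O (valid , i∉) = Valid-⊆ O mixed (O⊆ R) valid , i∉ ∘ O⊆ R i

        free-all : Avoiding x i mixed → ∀ a → Free a (lookup R a)
        free-all (valid , _) a with lookup R a in eq
        ... | false = tt
        ... | true  = λ t → Valid-⊆ (O [ a ]≔ true) mixed (sub t) valid
          where
          sub : Top x i a → ∀ e → In (O [ a ]≔ true) e → In mixed e
          sub t e e∈ with e Fin.≟ a
          ... | yes refl = trans (lookup-top S R t) eq
          ... | no e≢a   = O⊆ R e (In-insert O e∈ e≢a)

        -- This is the independence: available tops may be switched on separately. Up to repetition,
        -- a bad quadruple in the mixture contains at most one top by `tops-separated`, so its other
        -- positions lie in `O` and it would already contradict the availability of that top.
        avoiding-mixed : Avoiding x i O → (∀ a → Free a (lookup R a)) → Avoiding x i mixed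
        avoiding-mixed (valid , i∉) free = valid′ , i-mixed i∉
          where
          ≢i : ∀ {e} → In mixed e → e ≢ i
          ≢i e∈ refl = i-mixed i∉ e∈
          available : ∀ {a} → In mixed a → Top x i a → Valid x (O [ a ]≔ true)
          available {a} a∈ t with lookup R a | lookup-top S R t | free a
          ... | true  | _  | f = f t
          ... | false | eq | _ with trans (sym eq) a∈
          ... | ()
          top-first : ∀ {a j k l} → In mixed a → In mixed j → In mixed k → In mixed l → Top x i a → ¬ Bad x a j k l
          top-first {a} {j} {k} {l} a∈ j∈ k∈ l∈ t w = available a∈ t a j k l
            (lookup∘update a O true)
            (inside j∈ λ t′ → tops-separated t t′ (≢i k∈) (≢i l∈) w)
            (inside k∈ λ t′ → tops-separated t t′ (≢i j∈) (≢i l∈) (swap₂₃ w))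
            (inside l∈ λ t′ → tops-separated t t′ (≢i j∈) (≢i k∈) (swap₂₃ (swap₃₄ w))) w
            where
            inside : ∀ {e} → In mixed e → (Top x i e → e ≡ a) → In (O [ a ]≔ true) e
            inside {e} e∈ same with e Fin.≟ a
            ... | yes refl = lookup∘update a O true
            ... | no e≢a   = trans (lookup∘update′ e≢a O true) (⊆O R (e≢a ∘ same) e∈)
          valid′ : Valid x mixed
          valid′ j k l p j∈ k∈ l∈ p∈ w with Top? x i j | Top? x i k | Top? x i l | Top? x i p
          ... | yes t | _ | _ | _ = top-first j∈ k∈ l∈ p∈ t w
          ... | _ | yes t | _ | _ = top-first k∈ j∈ l∈ p∈ t (swap₁₂ w)
          ... | _ | _ | yes t | _ = top-first l∈ j∈ k∈ p∈ t (front₃ w)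
          ... | _ | _ | _ | yes t = top-first p∈ j∈ k∈ l∈ t (front₄ w)
          ... | no ¬j | no ¬k | no ¬l | no ¬p =
            valid j k l p (⊆O R ¬j j∈) (⊆O R ¬k k∈) (⊆O R ¬l l∈) (⊆O R ¬p p∈) w

        -- Whether `a` is hit depends on `R` through the bit at `a` alone, since the two larger
        -- members of a link are not tops and so belong to `O`.
        Hit-mixed⇒ : ∀ {a} → Hit x i mixed a → lookup R a ≡ true × Completes x i O a
        Hit-mixed⇒ (a∈ , b , c , b∈ , c∈ , a<b , a<c , l) =
          trans (sym (lookup-top S R (b , c , a<b , a<c , l))) a∈ ,
          b , c , ⊆O R (¬Top-second l a<b) b∈ , ⊆O R (¬Top-second (Link-acb l) a<c) c∈ , a<b , a<c , l

        Hit-mixed⇐ : ∀ {a} → lookup R a ≡ true × Completes x i O a → Hit x i mixed a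
        Hit-mixed⇐ (a∈ , b , c , b∈ , c∈ , a<b , a<c , l) =
          trans (lookup-top S R (b , c , a<b , a<c , l)) a∈ ,
          b , c , O⊆ R b b∈ , O⊆ R c c∈ , a<b , a<c , l

        no-hits : (∀ a → NoHit a (lookup R a)) → hits x i mixed ≡ 0
        no-hits h = ∑-none (allFin M) λ a → ind-no (λ hit → absurd a (Hit-mixed⇒ hit)) (Hit? x i mixed a)
          where
          absurd : ∀ a → ¬ (lookup R a ≡ true × Completes x i O a)
          absurd a (a∈ , comp) with lookup R a | h a
          absurd a (refl , comp) | true | f = f comp

        -- An exponential moment in place of the event: a set with at most `β` hits has weight 2^(β
        -- - hits) at least 1, and this weight is a product over the positions.
        few-hits : ∀ {β} → hits x i mixed ≤ β →
                   2 ^ M ≤ 2 ^ β * ∏ M (λ a → 1 + ind (NoHit? a (lookup R a)))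
        few-hits {β} h = ≤-trans (∏-count M H?)
          (*-mono-≤ (^-monoʳ-≤ 2 (≤-trans (∑-mono (allFin M) (λ a → ind-mono Hit-mixed⇐ (H? a) (Hit? x i mixed a))) h))
                    (∏-mono M (λ a → +-monoʳ-≤ 1 (ind-mono (to a) (¬? (H? a)) (NoHit? a (lookup R a))))))
          where
          H? : ∀ a → Dec (lookup R a ≡ true × Completes x i O a)
          H? a = (lookup R a Bool.≟ true) ×-dec Completes? x i O a
          to : ∀ a → ¬ (lookup R a ≡ true × Completes x i O a) → NoHit a (lookup R a)
          to a ¬h with lookup R a
          ... | true  = λ c → ¬h (refl , c)
          ... | false = tt

      -- When `O` is avoiding, the products of `w₂` and `w₃` over all positions are the indicators
      -- that the mixture is avoiding, respectively avoiding without hits; the product of `w₁` is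
      -- 2^(M - hits) on avoiding mixtures and 0 elsewhere.
      w₁ w₂ w₃ : Fin M → Bool → ℕ
      w₁ a r = ind (Free? a r) * (1 + ind (NoHit? a r))
      w₂ a r = ind (Free? a r)
      w₃ a r = ind (Free? a r ×-dec NoHit? a r)

      total : (Fin M → Bool → ℕ) → ℕ
      total w = ∏ M (λ a → w a true + w a false)

      -- The exponent 3 comes from (3/4)³ ≤ 1/2: an available top completing a triple
      -- is absent with probability 1/2 and has E[2^(- hits)] = 3/4.
      cubes-at : ∀ a → let A = w₂ a true + w₂ a false; B = w₃ a true + w₃ a false; C = w₁ a true + w₁ a false in
                 A * (C * C * C) ≤ B * (2 * A * (2 * A) * (2 * A))
      cubes-at a with Top? x i a →-dec Valid? x (O [ a ]≔ true) | ¬? (Completes? x i O a)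
      ... | no _  | _     = ≤-refl
      ... | yes _ | yes _ = ≤-refl
      ... | yes _ | no _  = m≤m+n 54 10

      total-cubes : total w₂ * (total w₁ * total w₁ * total w₁)
                  ≤ total w₃ * (2 ^ M * total w₂ * (2 ^ M * total w₂) * (2 ^ M * total w₂))
      total-cubes = begin
        total w₂ * (total w₁ * total w₁ * total w₁)
          ≡⟨ cong (total w₂ *_) (trans (cong (_* total w₁) (sym (∏-* M s₁ s₁))) (sym (∏-* M (λ a → s₁ a * s₁ a) s₁))) ⟩
        total w₂ * ∏ M (λ a → s₁ a * s₁ a * s₁ a)
          ≡⟨ ∏-* M s₂ _ ⟨
        ∏ M (λ a → s₂ a * (s₁ a * s₁ a * s₁ a))
          ≤⟨ ∏-mono M cubes-at ⟩
        ∏ M (λ a → s₃ a * (2 * s₂ a * (2 * s₂ a) * (2 * s₂ a)))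
          ≡⟨ ∏-* M s₃ _ ⟩
        total w₃ * ∏ M (λ a → 2 * s₂ a * (2 * s₂ a) * (2 * s₂ a))
          ≡⟨ cong (total w₃ *_) (trans (∏-* M (λ a → 2 * s₂ a * (2 * s₂ a)) (λ a → 2 * s₂ a)) (cong (_* ∏ M (λ a → 2 * s₂ a)) (∏-* M (λ a → 2 * s₂ a) (λ a → 2 * s₂ a)))) ⟩
        total w₃ * (D * D * D)
          ≡⟨ cong (λ d → total w₃ * (d * d * d)) (trans (∏-* M (λ _ → 2) s₂) (cong (_* total w₂) (∏-const M 2))) ⟩
        total w₃ * (2 ^ M * total w₂ * (2 ^ M * total w₂) * (2 ^ M * total w₂)) ∎
        where
        open ≤-Reasoning
        s₁ s₂ s₃ : Fin M → ℕ
        s₂ a = w₂ a true + w₂ a false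
        s₃ a = w₃ a true + w₃ a false
        s₁ a = w₁ a true + w₁ a false
        D = ∏ M (λ a → 2 * s₂ a)

      module _ (β : ℕ) where

        few? : ∀ S → Dec (Avoiding x i S × hits x i S ≤ β)
        few? S = Avoiding? x i S ×-dec hits x i S ≤? β

        none? : ∀ S → Dec (Avoiding x i S × hits x i S ≡ 0)
        none? S = Avoiding? x i S ×-dec hits x i S ≟ 0

        few-bound : ∀ R → 2 ^ M * ind (few? (resampled S R)) ≤ 2 ^ β * ∏ M (λ a → w₁ a (lookup R a))
        few-bound R with few? (resampled S R)
        ... | no _ = ≤-trans (≤-reflexive (*-zeroʳ (2 ^ M))) z≤n
        ... | yes (av , few) = ≤-trans (≤-reflexive (*-identityʳ (2 ^ M))) (≤-trans (few-hits R few)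
          (*-monoʳ-≤ (2 ^ β) (∏-mono M λ a → ≤-reflexive (sym
            (trans (cong (_* (1 + ind (NoHit? a (lookup R a)))) (ind-yes (free-all R av a) (Free? a (lookup R a))))
                   (*-identityˡ _))))))

        conditional : 10 * ∑ subsets (λ R → ind (few? (resampled S R)))
                    ≤ ∑ subsets (λ R → ind (Avoiding? x i (resampled S R)))
                      + 2 ^ β * 2 ^ β * 2 ^ β * 1000 * ∑ subsets (λ R → ind (none? (resampled S R)))
        conditional with Avoiding? x i O
        ... | no ¬av = ≤-trans (≤-reflexive (cong (10 *_)
              (∑-none subsets λ R → ind-no (¬av ∘ avoiding-O R ∘ proj₁) (few? (resampled S R))))) z≤n
        ... | yes av = dichotomy {total w₂} {total w₃} {total w₁} {2 ^ M} {2 ^ β}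
              (m^n>0 2 M)
              (∏-pos M (λ a → m≤n+m 1 (w₂ a true)))
              (∏-pos M (λ a → ≤-trans (s≤s z≤n) (m≤n+m 2 (w₁ a true))))
              total-cubes
              (begin
                2 ^ M * ∑ subsets (λ R → ind (few? (resampled S R)))             ≡⟨ ∑-*ˡ subsets (2 ^ M) _ ⟨
                ∑ subsets (λ R → 2 ^ M * ind (few? (resampled S R)))             ≤⟨ ∑-mono subsets few-bound ⟩
                ∑ subsets (λ R → 2 ^ β * ∏ M (λ a → w₁ a (lookup R a)))          ≡⟨ ∑-*ˡ subsets (2 ^ β) _ ⟩
                2 ^ β * ∑ subsets (λ R → ∏ M (λ a → w₁ a (lookup R a)))          ≡⟨ cong (2 ^ β *_) (∑-∏ M w₁) ⟩
                2 ^ β * total w₁                                                 ∎)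
              (≤-trans (≤-reflexive (sym (∑-∏ M w₂))) (∑-mono subsets λ R →
                ∏-ind M (Avoiding? x i (resampled S R)) (λ a → Free? a (lookup R a)) (avoiding-mixed R av)))
              (≤-trans (≤-reflexive (sym (∑-∏ M w₃))) (∑-mono subsets λ R →
                ∏-ind M (none? (resampled S R)) (λ a → Free? a (lookup R a) ×-dec NoHit? a (lookup R a))
                  (λ h → avoiding-mixed R av (proj₁ ∘ h) , no-hits R (proj₂ ∘ h))))
          where open ≤-Reasoning

    module _ (β : ℕ) where

      private
        few = λ S → ind (Avoiding? x i S ×-dec hits x i S ≤? β)
        avoiding = λ S → ind (Avoiding? x i S)
        none = λ S → ind (Avoiding? x i S ×-dec hits x i S ≟ 0)
        k = 2 ^ β * 2 ^ β * 2 ^ β * 1000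
        K = 2 ^ M

      -- `tops` does not depend on `S`, so `∑-mix` turns the average of `conditional` over `S` into
      -- the same inequality for uniform sets, each double sum being `2 ^ M` times a single one.
      few-versus-none : 10 * ∑ subsets few ≤ ∑ subsets avoiding + k * ∑ subsets none
      few-versus-none = *-cancelˡ-≤ K {{>-nonZero (m^n>0 2 M)}} (begin
        K * (10 * ∑ subsets few)
          ≡⟨ push 10 few ⟩
        ∑ subsets (λ S → 10 * ∑ subsets (λ R → few (resampled S R)))
          ≤⟨ ∑-mono subsets (λ S → Conditional.conditional S β) ⟩
        ∑ subsets (λ S → ∑ subsets (λ R → avoiding (resampled S R)) + k * ∑ subsets (λ R → none (resampled S R)))
          ≡⟨ ∑-+ subsets _ _ ⟩
        ∑ subsets (λ S → ∑ subsets (λ R → avoiding (resampled S R))) + ∑ subsets (λ S → k * ∑ subsets (λ R → none (resampled S R)))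
          ≡⟨ cong₂ _+_ (∑-mix bools tops avoiding) (sym (push k none)) ⟩
        K * ∑ subsets avoiding + K * (k * ∑ subsets none)
          ≡⟨ *-distribˡ-+ K _ _ ⟨
        K * (∑ subsets avoiding + k * ∑ subsets none) ∎)
        where
        open ≤-Reasoning
        push : ∀ c (f : Positions → ℕ) → K * (c * ∑ subsets f) ≡ ∑ subsets (λ S → c * ∑ subsets (λ R → f (resampled S R)))
        push c f = trans (*-exchange K c _) (trans (cong (c *_) (sym (∑-mix bools tops f))) (sym (∑-*ˡ subsets c _)))

-- Sparse colourings contain rainbow cliques

size : ∀ {M} → Vec Bool M → ℕ
size {M} S = ∑ (allFin M) (λ a → ind (lookup S a Bool.≟ true))

size-∷ : ∀ {M} s (S : Vec Bool M) → size (s ∷ S) ≡ ind (s Bool.≟ true) + size S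
size-∷ {M} s S = ∑-allFin-suc M (λ a → ind (lookup (s ∷ S) a Bool.≟ true))

choose : ∀ {M} (S : Vec Bool M) r → r ≤ size S →
         Σ (Fin r → Fin M) λ g → Injective _≡_ _≡_ g × (∀ a → lookup S (g a) ≡ true)
choose S zero _ = (λ ()) , (λ { {()} }) , λ ()
choose [] (suc r) ()
choose {suc M} (false ∷ S) r@(suc _) r≤ =
  let g , inj , g∈ = choose S r (≤-trans r≤ (≤-reflexive (size-∷ false S)))
  in suc ∘ g , inj ∘ Fin.suc-injective , g∈
choose {suc M} (true ∷ S) (suc r) r≤ =
  let g , inj , g∈ = choose S r (≤-pred (≤-trans r≤ (≤-reflexive (size-∷ true S))))
  in (λ { zero → zero ; (suc a) → suc (g a) })
   , (λ { {zero} {zero} _ → refl ; {suc a} {suc b} e → cong suc (inj (Fin.suc-injective e)) })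
   , (λ { zero → refl ; (suc a) → g∈ a })

Rainbow : ∀ {n} → (Fin n → Fin n → ℕ) → ℕ → Set
Rainbow {n} κ r = Σ (Fin r → Fin n) λ g → Injective _≡_ _≡_ g ×
  (∀ a b c d → a Fin.< b → c Fin.< d → κ (g a) (g b) ≡ κ (g c) (g d) → a ≡ c × b ≡ d)

third : ∀ {r} → 3 ≤ r → (a b : Fin r) → ∃ λ c → a ≢ c × b ≢ c
third (s≤s (s≤s (s≤s _))) zero          zero          = suc zero , (λ ()) , λ ()
third (s≤s (s≤s (s≤s _))) zero          (suc zero)    = suc (suc zero) , (λ ()) , λ ()
third (s≤s (s≤s (s≤s _))) zero          (suc (suc _)) = suc zero , (λ ()) , λ ()
third (s≤s (s≤s (s≤s _))) (suc zero)    zero          = suc (suc zero) , (λ ()) , λ ()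
third (s≤s (s≤s (s≤s _))) (suc (suc _)) zero          = suc zero , (λ ()) , λ ()
third (s≤s (s≤s (s≤s _))) (suc _)       (suc _)       = zero , (λ ()) , λ ()

4*[a+b+c]<4 : ∀ a b c → 4 * a + (4 * b + 4 * c) < 4 → a ≡ 0 × b ≡ 0 × c ≡ 0
4*[a+b+c]<4 a b c h = vanish a (m≤m+n _ _) , vanish b (≤-trans (m≤m+n _ _) (m≤n+m _ (4 * a)))
                    , vanish c (≤-trans (m≤n+m _ (4 * b)) (m≤n+m _ (4 * a)))
  where
  vanish : ∀ v → 4 * v ≤ 4 * a + (4 * b + 4 * c) → v ≡ 0
  vanish zero    _  = refl
  vanish (suc v) le = ⊥-elim (<⇒≱ (≤-<-trans le h) (m≤m*n 4 (suc v)))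

-- `W` and `P` count the valid sets with and without `i`, `F` and `G` split `P` into few and many
-- hits, and `Z` counts the hit-free ones. As `P ≤ 2 * F`, one gets `5 * P ≤ 10 * F ≤ P + k * W`; so
-- `i` lies in a share of at least `4 / (4 + k)` of the sets, more than the `1 / L` permitted.
overcrowded : ∀ {L k W P F G Z} → 4 + k < 4 * L → L * W ≤ W + P → P ≡ F + G → 2 * G ≤ P →
              10 * F ≤ P + k * Z → Z ≤ W → 1 ≤ P → ⊥
overcrowded {L} {k} {W} {P} {F} {G} {Z} L-large LW≤ P≡ 2G≤ 10F≤ Z≤ 1≤P =
  <⇒≱ L-large (*-cancelʳ-≤ (4 * L) (4 + k) W {{>-nonZero (W≥1 W 4P≤)}} (begin
    4 * L * W          ≡⟨ *-assoc 4 L W ⟩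
    4 * (L * W)        ≤⟨ *-monoʳ-≤ 4 LW≤ ⟩
    4 * (W + P)        ≡⟨ *-distribˡ-+ 4 W P ⟩
    4 * W + 4 * P      ≤⟨ +-monoʳ-≤ (4 * W) 4P≤ ⟩
    4 * W + k * W      ≡⟨ *-distribʳ-+ W 4 k ⟨
    (4 + k) * W        ∎))
  where
  open ≤-Reasoning
  regroup : ∀ a b → a + b + (a + b) ≡ 2 * a + 2 * b
  regroup = solve-∀
  P≤ : P ≤ 2 * F
  P≤ = +-cancelʳ-≤ P P (2 * F) (begin
    P + P            ≡⟨ cong (λ p → p + p) P≡ ⟩
    F + G + (F + G)  ≡⟨ regroup F G ⟩
    2 * F + 2 * G    ≤⟨ +-monoʳ-≤ (2 * F) 2G≤ ⟩
    2 * F + P        ∎)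
  4P≤ : 4 * P ≤ k * W
  4P≤ = +-cancelˡ-≤ P (4 * P) (k * W) (begin
    5 * P            ≤⟨ *-monoʳ-≤ 5 P≤ ⟩
    5 * (2 * F)      ≡⟨ *-assoc 5 2 F ⟨
    10 * F           ≤⟨ 10F≤ ⟩
    P + k * Z        ≤⟨ +-monoʳ-≤ P (*-monoʳ-≤ k Z≤) ⟩
    P + k * W        ∎)
  W≥1 : ∀ w → 4 * P ≤ k * w → 1 ≤ w
  W≥1 (suc _) _ = s≤s z≤n
  W≥1 zero    h = ⊥-elim (<⇒≱ (*-mono-≤ (s≤s (z≤n {3})) 1≤P) (≤-trans h (≤-reflexive (*-zeroʳ k))))

module Core {n} (κ : Fin n → Fin n → ℕ) (κ-sym : ∀ u v → κ u v ≡ κ v u) (M : ℕ) where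

  open Sets κ κ-sym M

  valid⇒rainbow : ∀ {r} x S → 3 ≤ r → Valid x S → r ≤ size S → Rainbow κ r
  valid⇒rainbow {r} x S 3≤r valid r≤ with choose S r r≤
  ... | g , g-inj , g∈ = lookup x ∘ g , inj , rainbow
    where
    no-clash : ∀ {a b c d} → ¬ Clash x (g a) (g b) (g c) (g d)
    no-clash {a} {b} {c} {d} cl = valid _ _ _ _ (g∈ a) (g∈ b) (g∈ c) (g∈ d) (ij∥kl cl)
    -- A repeated label would give the edges to a third position equal colours; this is where
    -- `3 ≤ r` enters.
    inj : Injective _≡_ _≡_ (lookup x ∘ g)
    inj {a} {b} e = decidable-stable (a Fin.≟ b) λ a≢b →
      let c , a≢c , b≢c = third 3≤r a b in
      no-clash {a} {c} {b} {c} (clash (a≢c ∘ g-inj) (b≢c ∘ g-inj) (a≢b ∘ g-inj ∘ proj₁) (a≢c ∘ g-inj ∘ proj₁)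
                         (cong (λ u → κ u (lookup x (g c))) e))
    rainbow : ∀ a b c d → a Fin.< b → c Fin.< d → colour x (g a) (g b) ≡ colour x (g c) (g d) → a ≡ c × b ≡ d
    rainbow a b c d a<b c<d e = decidable-stable (a Fin.≟ c ×-dec b Fin.≟ d) λ different →
      no-clash {a} {b} {c} {d} (clash (Fin.<⇒≢ a<b ∘ g-inj) (Fin.<⇒≢ c<d ∘ g-inj)
        (λ (p , q) → different (g-inj p , g-inj q))
        (λ (p , q) → Fin.<-asym a<b (subst₂ Fin._<_ (sym (g-inj q)) (sym (g-inj p)) c<d)) e)

  module Counting (m : ℕ) (degree : ∀ u k → ∑ (allFin n) (λ w → ind (κ u w ≟ k)) ≤ m)
                  (r : ℕ) (small : ∀ x S → Valid x S → size S ≤ r) where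

    open Sparse m degree

    positions : List (Fin M)
    positions = allFin M

    #valid : Labelling → ℕ
    #valid x = ∑ subsets (λ S → ind (Valid? x S))

    #with #avoiding : Labelling → Fin M → ℕ
    #with     x i = ∑ subsets (λ S → ind (Valid? x S ×-dec In? S i))
    #avoiding x i = ∑ subsets (λ S → ind (Avoiding? x i S))

    #valid-split : ∀ x i → #valid x ≡ #with x i + #avoiding x i
    #valid-split x i = trans (∑-cong subsets split) (∑-+ subsets _ _)
      where
      split : ∀ S → ind (Valid? x S) ≡ ind (Valid? x S ×-dec In? S i) + ind (Avoiding? x i S)
      split S with In? S i
      ... | yes i∈ = sym (trans (cong₂ _+_ (ind-cong proj₁ (_, i∈) (Valid? x S ×-dec yes i∈) (Valid? x S))
                                           (ind-no (λ (_ , i∉) → i∉ i∈) (Avoiding? x i S)))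
                                (+-identityʳ _))
      ... | no i∉  = sym (cong₂ _+_ (ind-no (i∉ ∘ proj₂) (Valid? x S ×-dec no i∉))
                                    (ind-cong proj₁ (_, i∉) (Avoiding? x i S) (Valid? x S)))

    empty : Positions
    empty = replicate M false

    ∉empty : ∀ {a} → ¬ In empty a
    ∉empty {a} a∈ with trans (sym (lookup-replicate a false)) a∈
    ... | ()

    #avoiding≥1 : ∀ x i → 1 ≤ #avoiding x i
    #avoiding≥1 x i = ≤-trans
      (≤-reflexive (sym (ind-yes ((λ j k l p j∈ → ⊥-elim (∉empty j∈)) , ∉empty) (Avoiding? x i empty))))
      (∑-∈ (λ S → ind (Avoiding? x i S)) (∈-vecs ∈-bools empty))

    module Occupancy (L : ℕ) (L-small : 4 * (L * r) ≤ M) where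

      frequent : Labelling → Fin M → ℕ
      frequent x i = ind (#valid x <? L * #with x i)

      -- The probabilities of `i` belonging to `S` sum over `i` to the mean size of `S`, which is at
      -- most `r`; so at most `L * r` positions exceed `1 / L`.
      ∑-frequent : ∀ x → 4 * ∑ positions (frequent x) ≤ M
      ∑-frequent x = ≤-trans (*-monoʳ-≤ 4 (*-cancelʳ-≤ (∑ positions (frequent x)) (L * r) V {{>-nonZero V≥1}} (begin
        ∑ positions (frequent x) * V
          ≡⟨ ∑-*ʳ positions V _ ⟨
        ∑ positions (λ i → frequent x i * V)
          ≤⟨ ∑-mono positions at ⟩
        ∑ positions (λ i → L * #with x i)
          ≡⟨ trans (∑-*ˡ positions L _) (cong (L *_) (∑-swap positions subsets _)) ⟩
        L * ∑ subsets (λ S → ∑ positions (λ i → ind (Valid? x S ×-dec In? S i)))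
          ≡⟨ cong (L *_) (∑-cong subsets λ S → trans (∑-cong positions (λ i → ind-* (Valid? x S) (In? S i))) (∑-*ˡ positions (ind (Valid? x S)) _)) ⟩
        L * ∑ subsets (λ S → ind (Valid? x S) * size S)
          ≤⟨ *-monoʳ-≤ L (∑-mono subsets size-bound) ⟩
        L * ∑ subsets (λ S → ind (Valid? x S) * r)
          ≡⟨ cong (L *_) (∑-*ʳ subsets r _) ⟩
        L * (V * r)
          ≡⟨ rearrange L V r ⟩
        L * r * V ∎))) L-small
        where
        open ≤-Reasoning
        V = #valid x
        rearrange : ∀ a b c → a * (b * c) ≡ a * c * b
        rearrange = solve-∀
        V≥1 : 1 ≤ V
        V≥1 = ≤-trans
          (≤-reflexive (sym (ind-yes (λ j k l p j∈ → ⊥-elim (∉empty j∈)) (Valid? x empty))))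
          (∑-∈ (λ S → ind (Valid? x S)) (∈-vecs ∈-bools empty))
        at : ∀ i → frequent x i * V ≤ L * #with x i
        at i with #valid x <? L * #with x i
        ... | yes lt = ≤-trans (≤-reflexive (*-identityˡ V)) (<⇒≤ lt)
        ... | no _   = z≤n
        size-bound : ∀ S → ind (Valid? x S) * size S ≤ ind (Valid? x S) * r
        size-bound S with Valid? x S
        ... | yes v = *-monoʳ-≤ 1 (small x S v)
        ... | no _  = z≤n

    -- The hits are at most the ordered triples in `S` that form a link with `i`, and each triple
    -- does so for at most `codegree` of the labels `z`.
    ∑-hits : ∀ x i S → ∑ vertices (λ z → hits (x [ i ]≔ z) i S) ≤ size S * (size S * (size S * codegree))
    ∑-hits x i S = begin
      ∑ vertices (λ z → hits (x [ i ]≔ z) i S)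
        ≤⟨ ∑-mono vertices (λ z → ∑-mono positions (pointwise z)) ⟩
      ∑ vertices (λ z → ∑ positions λ a → s a * ∑ positions λ b → s b * ∑ positions λ c → s c * f z a b c)
        ≡⟨ pull vertices s ⟩
      ∑ positions (λ a → s a * ∑ vertices λ z → ∑ positions λ b → s b * ∑ positions λ c → s c * f z a b c)
        ≡⟨ ∑-cong positions (λ a → cong (s a *_) (pull vertices s)) ⟩
      ∑ positions (λ a → s a * ∑ positions λ b → s b * ∑ vertices λ z → ∑ positions λ c → s c * f z a b c)
        ≡⟨ ∑-cong positions (λ a → cong (s a *_) (∑-cong positions λ b → cong (s b *_) (pull vertices s))) ⟩
      ∑ positions (λ a → s a * ∑ positions λ b → s b * ∑ positions λ c → s c * ∑ vertices λ z → f z a b c)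
        ≤⟨ weigh (λ a → weigh λ b → weigh λ c → Link-free x) ⟩
      size S * (size S * (size S * codegree)) ∎
      where
      open ≤-Reasoning
      s : Fin M → ℕ
      s a = ind (In? S a)
      f : Fin n → Fin M → Fin M → Fin M → ℕ
      f z a b c = ind (Link? (x [ i ]≔ z) i a b c)
      pull : ∀ (zs : List (Fin n)) (w : Fin M → ℕ) {g : Fin n → Fin M → ℕ} →
             ∑ zs (λ z → ∑ positions λ a → w a * g z a) ≡ ∑ positions (λ a → w a * ∑ zs λ z → g z a)
      pull zs w = trans (∑-swap zs positions _) (∑-cong positions λ a → ∑-*ˡ zs (w a) _)
      weigh : ∀ {g : Fin M → ℕ} {k} → (∀ a → g a ≤ k) → ∑ positions (λ a → s a * g a) ≤ size S * k
      weigh {k = k} h = ≤-trans (∑-mono positions (λ a → *-monoʳ-≤ (s a) (h a))) (≤-reflexive (∑-*ʳ positions k s))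
      one : ∀ {a} {g : Fin M → ℕ} → In S a → 1 ≤ g a → 1 ≤ ∑ positions (λ a → s a * g a)
      one {a} {g} a∈ h = ≤-trans (*-mono-≤ (≤-reflexive (sym (ind-yes a∈ (In? S a)))) h)
                                 (∑-∈ (λ a → s a * g a) (∈-allFin a))
      pointwise : ∀ z a → ind (Hit? (x [ i ]≔ z) i S a)
                        ≤ s a * ∑ positions λ b → s b * ∑ positions λ c → s c * f z a b c
      pointwise z a = ind-≤ (Hit? (x [ i ]≔ z) i S a) λ { (a∈ , b , c , b∈ , c∈ , _ , _ , l) →
        *-mono-≤ (≤-reflexive (sym (ind-yes a∈ (In? S a))))
          (one b∈ (one c∈ (≤-reflexive (sym (ind-yes l (Link? (x [ i ]≔ z) i a b c)))))) }

    -- A set without `i` does not see the label at `i`, so the family of avoiding sets stays the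
    -- same while that label is redrawn.
    Avoiding-resample : ∀ x i z S → Avoiding (x [ i ]≔ z) i S → Avoiding x i S
    Avoiding-resample x i z S (valid , i∉) =
      (λ j k l p j∈ k∈ l∈ p∈ w → valid j k l p j∈ k∈ l∈ p∈
        (Bad-resample⁻¹ (≢i j∈) (≢i k∈) (≢i l∈) (≢i p∈) w)) , i∉
      where
      ≢i : ∀ {e} → In S e → e ≢ i
      ≢i e∈ refl = i∉ e∈

    Avoiding-resample⁻¹ : ∀ x i z S → Avoiding x i S → Avoiding (x [ i ]≔ z) i S
    Avoiding-resample⁻¹ x i z S (valid , i∉) =
      (λ j k l p j∈ k∈ l∈ p∈ w → valid j k l p j∈ k∈ l∈ p∈
        (Bad-resample (≢i j∈) (≢i k∈) (≢i l∈) (≢i p∈) w)) , i∉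
      where
      ≢i : ∀ {e} → In S e → e ≢ i
      ≢i e∈ refl = i∉ e∈

    module Blocking (β : ℕ) (β-large : 24 * (r * r * r) * m ≤ n * suc β) where

      many? : ∀ x i S → Dec (Avoiding x i S × ¬ (hits x i S ≤ β))
      many? x i S = Avoiding? x i S ×-dec ¬? (hits x i S ≤? β)

      few? : ∀ x i S → Dec (Avoiding x i S × hits x i S ≤ β)
      few? x i S = Avoiding? x i S ×-dec hits x i S ≤? β

      #many #few : Labelling → Fin M → ℕ
      #many x i = ∑ subsets (λ S → ind (many? x i S))
      #few  x i = ∑ subsets (λ S → ind (few? x i S))

      #avoiding-split : ∀ x i → #avoiding x i ≡ #few x i + #many x i
      #avoiding-split x i = trans (∑-cong subsets split) (∑-+ subsets _ _)
        where
        split : ∀ S → ind (Avoiding? x i S) ≡ ind (few? x i S) + ind (many? x i S)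
        split S with hits x i S ≤? β
        ... | yes h = sym (trans (cong₂ _+_ (ind-cong proj₁ (_, h) (Avoiding? x i S ×-dec yes h) (Avoiding? x i S))
                                            (ind-no (λ (_ , ¬h) → ¬h h) (Avoiding? x i S ×-dec ¬? (yes h))))
                                 (+-identityʳ _))
        ... | no ¬h = sym (cong₂ _+_ (ind-no (¬h ∘ proj₂) (Avoiding? x i S ×-dec no ¬h))
                                     (ind-cong proj₁ (_, ¬h) (Avoiding? x i S ×-dec ¬? (no ¬h)) (Avoiding? x i S)))

      blocked : Labelling → Fin M → ℕ
      blocked x i = ind (#avoiding x i <? 2 * #many x i)

      ∑-many : ∀ x i → suc β * ∑ vertices (λ z → #many (x [ i ]≔ z) i) ≤ #avoiding x i * (r * (r * (r * codegree)))
      ∑-many x i = begin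
        suc β * ∑ vertices (λ z → #many (x [ i ]≔ z) i)
          ≡⟨ trans (cong (suc β *_) (∑-swap vertices subsets _)) (sym (∑-*ˡ subsets (suc β) _)) ⟩
        ∑ subsets (λ S → suc β * ∑ vertices (λ z → ind (many? (x [ i ]≔ z) i S)))
          ≤⟨ ∑-mono subsets at ⟩
        ∑ subsets (λ S → ind (Avoiding? x i S) * (r * (r * (r * codegree))))
          ≡⟨ ∑-*ʳ subsets _ _ ⟩
        #avoiding x i * (r * (r * (r * codegree))) ∎
        where
        open ≤-Reasoning
        markov : ∀ S z → suc β * ind (many? (x [ i ]≔ z) i S) ≤ hits (x [ i ]≔ z) i S
        markov S z with many? (x [ i ]≔ z) i S
        ... | yes (_ , h) = ≤-trans (≤-reflexive (*-identityʳ (suc β))) (≰⇒> h)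
        ... | no _        = ≤-trans (≤-reflexive (*-zeroʳ (suc β))) z≤n
        at : ∀ S → suc β * ∑ vertices (λ z → ind (many? (x [ i ]≔ z) i S)) ≤ ind (Avoiding? x i S) * (r * (r * (r * codegree)))
        at S with Avoiding? x i S
        ... | no ¬av = ≤-reflexive (trans (cong (suc β *_)
                (∑-none vertices λ z → ind-no (¬av ∘ Avoiding-resample x i z S ∘ proj₁) (many? (x [ i ]≔ z) i S))) (*-zeroʳ (suc β)))
        ... | yes (valid , _) = begin
          suc β * ∑ vertices (λ z → ind (many? (x [ i ]≔ z) i S))  ≡⟨ ∑-*ˡ vertices (suc β) _ ⟨
          ∑ vertices (λ z → suc β * ind (many? (x [ i ]≔ z) i S))  ≤⟨ ∑-mono vertices (markov S) ⟩
          ∑ vertices (λ z → hits (x [ i ]≔ z) i S)                 ≤⟨ ∑-hits x i S ⟩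
          size S * (size S * (size S * codegree))                     ≤⟨ *-mono-≤ s≤r (*-mono-≤ s≤r (*-monoˡ-≤ codegree s≤r)) ⟩
          r * (r * (r * codegree))                                    ≡⟨ *-identityˡ _ ⟨
          1 * (r * (r * (r * codegree)))                              ∎
          where
          s≤r : size S ≤ r
          s≤r = small x S valid

      -- Markov twice: at most 1/8 of the pairs of a label `z` and an avoiding set have more than
      -- `β` hits, hence at most 1/4 of the labels have this for over half of the sets. The 24 in
      -- `β-large` is this 8 times the 3 from `codegree`.
      ∑-blocked-at : ∀ x i → 4 * ∑ vertices (λ z → blocked (x [ i ]≔ z) i) ≤ n
      ∑-blocked-at x i = *-cancelʳ-≤ _ _ (suc β * P) {{>-nonZero (*-mono-≤ (s≤s (z≤n {β})) (#avoiding≥1 x i))}} (begin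
        4 * B * (suc β * P)                                          ≡⟨ rearrange₁ B (suc β) P ⟩
        4 * (suc β * (B * P))                                        ≤⟨ *-monoʳ-≤ 4 (*-monoʳ-≤ (suc β) BP≤) ⟩
        4 * (suc β * (2 * D))                                        ≡⟨ rearrange₂ (suc β) D ⟩
        8 * (suc β * D)                                              ≤⟨ *-monoʳ-≤ 8 (∑-many x i) ⟩
        8 * (P * (r * (r * (r * codegree))))                            ≡⟨ rearrange₃ P r m ⟩
        24 * (r * r * r) * m * P                                     ≤⟨ *-monoˡ-≤ P β-large ⟩
        n * suc β * P                                                ≡⟨ *-assoc n (suc β) P ⟩
        n * (suc β * P)                                              ∎)
        where
        open ≤-Reasoning
        P = #avoiding x i
        B = ∑ vertices (λ z → blocked (x [ i ]≔ z) i)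
        D = ∑ vertices (λ z → #many (x [ i ]≔ z) i)
        rearrange₁ : ∀ b s p → 4 * b * (s * p) ≡ 4 * (s * (b * p))
        rearrange₁ = solve-∀
        rearrange₂ : ∀ s d → 4 * (s * (2 * d)) ≡ 8 * (s * d)
        rearrange₂ = solve-∀
        rearrange₃ : ∀ p r m → 8 * (p * (r * (r * (r * (3 * m))))) ≡ 24 * (r * r * r) * m * p
        rearrange₃ = solve-∀
        same : ∀ z → #avoiding (x [ i ]≔ z) i ≡ P
        same z = ∑-cong subsets λ S →
          ind-cong (Avoiding-resample x i z S) (Avoiding-resample⁻¹ x i z S) (Avoiding? (x [ i ]≔ z) i S) (Avoiding? x i S)
        at : ∀ z → blocked (x [ i ]≔ z) i * P ≤ 2 * #many (x [ i ]≔ z) i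
        at z with #avoiding (x [ i ]≔ z) i <? 2 * #many (x [ i ]≔ z) i
        ... | yes lt = ≤-trans (≤-reflexive (trans (*-identityˡ P) (sym (same z)))) (<⇒≤ lt)
        ... | no _   = z≤n
        BP≤ : B * P ≤ 2 * D
        BP≤ = ≤-trans (≤-reflexive (sym (∑-*ʳ vertices P _)))
                (≤-trans (∑-mono vertices at) (≤-reflexive (∑-*ˡ vertices 2 _)))

      ∑-blocked : 1 ≤ n → ∀ i → 4 * ∑ labellings (λ x → blocked x i) ≤ #all
      ∑-blocked 1≤n i = *-cancelˡ-≤ n {{>-nonZero 1≤n}} (begin
        n * (4 * ∑ labellings (λ x → blocked x i))                              ≡⟨ *-exchange n 4 _ ⟩
        4 * (n * ∑ labellings (λ x → blocked x i))                              ≡⟨ cong (4 *_) (resample i (λ x → blocked x i)) ⟨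
        4 * ∑ labellings (λ x → ∑ vertices (λ z → blocked (x [ i ]≔ z) i))      ≡⟨ ∑-*ˡ labellings 4 _ ⟨
        ∑ labellings (λ x → 4 * ∑ vertices (λ z → blocked (x [ i ]≔ z) i))      ≤⟨ ∑-mono labellings (λ x → ∑-blocked-at x i) ⟩
        ∑ labellings (λ x → n)                                                  ≡⟨ ∑-cong labellings (λ _ → *-identityʳ n) ⟨
        ∑ labellings (λ x → n * 1)                                              ≡⟨ ∑-*ˡ labellings n _ ⟩
        n * #all                                                                ∎)
        where
        open ≤-Reasoning

    tuples : ∀ k → List (Vec (Fin M) k)
    tuples k = vecs positions k

    ∑-tuples : ∀ k {f : Vec (Fin M) k → ℕ} {c} → (∀ t → f t ≤ c) → ∑ (tuples k) f ≤ M ^ k * c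
    ∑-tuples k {c = c} h = ≤-trans (∑-bound (tuples k) h)
      (≤-reflexive (cong (_* c) (trans (length-vecs positions k) (cong (_^ k) (length-allFin M)))))

    violations : Labelling → Fin M → ℕ
    violations x i = ∑ (tuples 2) (λ t → ind (Chord? x i t)) + (∑ (tuples 5) (λ t → ind (TwoLinks? x i t))
                   + (∑ (tuples 5) (λ t → ind (LinkChord? x i t)) + ∑ (tuples 8) (λ t → ind (LinkLinkChord? x i t))))

    clean : ∀ {x i} → violations x i ≡ 0 → Clean x i
    clean {x} {i} none = record
      { noChord         = λ t → vanish (Chord? x i) t (m+n≡0⇒m≡0 _ none)
      ; noTwoLinks      = λ t → vanish (TwoLinks? x i) t (m+n≡0⇒m≡0 _ rest₁)
      ; noLinkChord     = λ t → vanish (LinkChord? x i) t (m+n≡0⇒m≡0 _ rest₂)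
      ; noLinkLinkChord = λ t → vanish (LinkLinkChord? x i) t (m+n≡0⇒n≡0 (∑ (tuples 5) (λ t → ind (LinkChord? x i t))) rest₂)
      }
      where
      rest₁ = m+n≡0⇒n≡0 (∑ (tuples 2) (λ t → ind (Chord? x i t))) none
      rest₂ = m+n≡0⇒n≡0 (∑ (tuples 5) (λ t → ind (TwoLinks? x i t))) rest₁
      vanish : ∀ {k} {P : Vec (Fin M) k → Set} (P? : ∀ t → Dec (P t)) t → ∑ (tuples k) (λ t → ind (P? t)) ≡ 0 → ¬ P t
      vanish P? t zero-sum = ind-zero (P? t)
        (n≤0⇒n≡0 (≤-trans (∑-∈ (λ t → ind (P? t)) (∈-vecs ∈-allFin t)) (≤-reflexive zero-sum)))

    module Sparsity (n-large : 4 * (n * n * (M ^ 2 * (codegree + codegree)) + 2 * (n * (M ^ 5 * (codegree * codegree)))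
                                  + M ^ 8 * (codegree * codegree * codegree)) ≤ n * n * n) where

      -- A union bound over tuples, multiplied by n³: `M ^ 2` chords with one coincidence, two kinds
      -- of `M ^ 5` tuples with two, and `M ^ 8` tuples with three.
      ∑-violations : 1 ≤ n → ∀ i → 4 * ∑ labellings (λ x → violations x i) ≤ #all
      ∑-violations 1≤n i = *-cancelˡ-≤ (n * n * n) {{>-nonZero (*-mono-≤ (*-mono-≤ 1≤n 1≤n) 1≤n)}} (begin
        n * n * n * (4 * ∑ labellings (λ x → violations x i))
          ≡⟨ cong (λ v → n * n * n * (4 * v)) split ⟩
        n * n * n * (4 * (v₁ + (v₂ + (v₃ + v₄))))
          ≡⟨ distribute n v₁ v₂ v₃ v₄ ⟩
        4 * (n * n * (n * v₁) + (n * (n * (n * v₂)) + n * (n * (n * v₃))) + n * (n * (n * v₄)))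
          ≤⟨ *-monoʳ-≤ 4 (+-mono-≤ (+-mono-≤ (*-monoʳ-≤ (n * n) b₁) (+-mono-≤ (*-monoʳ-≤ n b₂) (*-monoʳ-≤ n b₃))) b₄) ⟩
        4 * (n * n * (M ^ 2 * ((codegree + codegree) * #all))
            + (n * (M ^ 5 * (codegree * (codegree * #all))) + n * (M ^ 5 * (codegree * (codegree * #all))))
            + M ^ 8 * (codegree * (codegree * (codegree * #all))))
          ≡⟨ collect n (M ^ 2) (M ^ 5) (M ^ 8) codegree #all ⟩
        4 * (n * n * (M ^ 2 * (codegree + codegree)) + 2 * (n * (M ^ 5 * (codegree * codegree))) + M ^ 8 * (codegree * codegree * codegree)) * #all
          ≤⟨ *-monoˡ-≤ #all n-large ⟩
        n * n * n * #all ∎)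
        where
        open ≤-Reasoning
        v₁ = ∑ (tuples 2) (λ t → # (λ x → Chord? x i t))
        v₂ = ∑ (tuples 5) (λ t → # (λ x → TwoLinks? x i t))
        v₃ = ∑ (tuples 5) (λ t → # (λ x → LinkChord? x i t))
        v₄ = ∑ (tuples 8) (λ t → # (λ x → LinkLinkChord? x i t))
        swap-sum : ∀ k {P : Labelling → Vec (Fin M) k → Set} (P? : ∀ x t → Dec (P x t)) →
                   ∑ labellings (λ x → ∑ (tuples k) (λ t → ind (P? x t))) ≡ ∑ (tuples k) (λ t → # (λ x → P? x t))
        swap-sum k P? = ∑-swap labellings (tuples k) _
        split : ∑ labellings (λ x → violations x i) ≡ v₁ + (v₂ + (v₃ + v₄))
        split = trans (∑-+ labellings _ _) (cong₂ _+_ (swap-sum 2 (λ x → Chord? x i))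
               (trans (∑-+ labellings _ _) (cong₂ _+_ (swap-sum 5 (λ x → TwoLinks? x i))
               (trans (∑-+ labellings _ _) (cong₂ _+_ (swap-sum 5 (λ x → LinkChord? x i)) (swap-sum 8 (λ x → LinkLinkChord? x i)))))))
        distribute : ∀ n a b c d → n * n * n * (4 * (a + (b + (c + d))))
          ≡ 4 * (n * n * (n * a) + (n * (n * (n * b)) + n * (n * (n * c))) + n * (n * (n * d)))
        distribute = solve-∀
        collect : ∀ n p q s t u → 4 * (n * n * (p * ((t + t) * u)) + (n * (q * (t * (t * u))) + n * (q * (t * (t * u)))) + s * (t * (t * (t * u))))
          ≡ 4 * (n * n * (p * (t + t)) + 2 * (n * (q * (t * t))) + s * (t * t * t)) * u
        collect = solve-∀
        b₁ : n * v₁ ≤ M ^ 2 * ((codegree + codegree) * #all)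
        b₁ = ≤-trans (≤-reflexive (sym (∑-*ˡ (tuples 2) n _))) (∑-tuples 2 (#Chord i))
        push₂ : ∀ k (f : Vec (Fin M) k → ℕ) → n * (n * ∑ (tuples k) f) ≡ ∑ (tuples k) (λ t → n * (n * f t))
        push₂ k f = trans (cong (n *_) (sym (∑-*ˡ (tuples k) n f))) (sym (∑-*ˡ (tuples k) n _))
        b₂ : n * (n * v₂) ≤ M ^ 5 * (codegree * (codegree * #all))
        b₂ = ≤-trans (≤-reflexive (push₂ 5 _)) (∑-tuples 5 (#TwoLinks i))
        b₃ : n * (n * v₃) ≤ M ^ 5 * (codegree * (codegree * #all))
        b₃ = ≤-trans (≤-reflexive (push₂ 5 _)) (∑-tuples 5 (#LinkChord i))
        b₄ : n * (n * (n * v₄)) ≤ M ^ 8 * (codegree * (codegree * (codegree * #all)))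
        b₄ = ≤-trans (≤-reflexive (trans (cong (n *_) (push₂ 8 _)) (sym (∑-*ˡ (tuples 8) n _)))) (∑-tuples 8 (#LinkLinkChord i))

    -- Adding `i` is injective on sets avoiding `i`, and by `Local.extend` it keeps the hit-free
    -- ones valid. Both sums are first averaged over the bit at `i`, so that the injection merely
    -- turns `false` into `true` there.
    none≤with : ∀ x i → Clean x i → ∑ subsets (λ S → ind (Avoiding? x i S ×-dec hits x i S ≟ 0)) ≤ #with x i
    none≤with x i cl = *-cancelˡ-≤ 2 (begin
      2 * ∑ subsets none                                        ≡⟨ ∑-resample bools i none ⟨
      ∑ subsets (λ S → none (S [ i ]≔ true) + (none (S [ i ]≔ false) + 0))
                                                                ≤⟨ ∑-mono subsets at ⟩
      ∑ subsets (λ S → with-i (S [ i ]≔ true) + (with-i (S [ i ]≔ false) + 0))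
                                                                ≡⟨ ∑-resample bools i with-i ⟩
      2 * #with x i                                             ∎)
      where
      open ≤-Reasoning
      none with-i : Positions → ℕ
      none S = ind (Avoiding? x i S ×-dec hits x i S ≟ 0)
      with-i S = ind (Valid? x S ×-dec In? S i)
      at : ∀ S → none (S [ i ]≔ true) + (none (S [ i ]≔ false) + 0) ≤ with-i (S [ i ]≔ true) + (with-i (S [ i ]≔ false) + 0)
      at S = begin
        none (S [ i ]≔ true) + (none (S [ i ]≔ false) + 0)
          ≡⟨ cong₂ _+_ (ind-no (λ ((_ , i∉) , _) → i∉ (lookup∘update i S true)) (Avoiding? x i (S [ i ]≔ true) ×-dec hits x i (S [ i ]≔ true) ≟ 0)) (+-identityʳ _) ⟩
        none (S [ i ]≔ false)
          ≤⟨ ind-mono (λ (av , h) → subst (Valid x) ([]≔-idempotent S i) (Local.extend x i cl av h) , lookup∘update i S true)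
               (Avoiding? x i (S [ i ]≔ false) ×-dec hits x i (S [ i ]≔ false) ≟ 0) (Valid? x (S [ i ]≔ true) ×-dec In? (S [ i ]≔ true) i) ⟩
        with-i (S [ i ]≔ true)
          ≤⟨ m≤m+n _ _ ⟩
        with-i (S [ i ]≔ true) + (with-i (S [ i ]≔ false) + 0) ∎

    module Contradiction (L β : ℕ) (1≤n : 1 ≤ n) (1≤M : 1 ≤ M)
      (L-small : 4 * (L * r) ≤ M)
      (β-large : 24 * (r * r * r) * m ≤ n * suc β)
      (L-large : 4 + 2 ^ β * 2 ^ β * 2 ^ β * 1000 < 4 * L)
      (n-large : 4 * (n * n * (M ^ 2 * (codegree + codegree)) + 2 * (n * (M ^ 5 * (codegree * codegree)))
                        + M ^ 8 * (codegree * codegree * codegree)) ≤ n * n * n) where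

      open Occupancy L L-small
      open Blocking β β-large
      open Sparsity n-large

      defects : Labelling → Fin M → ℕ
      defects x i = 4 * frequent x i + (4 * blocked x i + 4 * violations x i)

      -- Each of the three kinds of defect has mean at most 1/4 over labellings and positions, so
      -- `defects` averages at most 3. Being a multiple of 4, a value below 4 must then be 0.
      ∑-defects : ∑ labellings (λ x → ∑ positions (defects x)) < ∑ labellings (λ x → ∑ positions (λ _ → 4))
      ∑-defects = begin-strict
        ∑ labellings (λ x → ∑ positions (defects x))
          ≡⟨ ∑-cong labellings (λ x → trans (∑-+ positions _ _) (cong₂ _+_ (∑-*ˡ positions 4 _) (∑-+ positions _ _))) ⟩
        ∑ labellings (λ x → 4 * ∑ positions (frequent x) + (∑ positions (λ i → 4 * blocked x i) + ∑ positions (λ i → 4 * violations x i)))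
          ≡⟨ trans (∑-+ labellings _ _) (cong (∑ labellings (λ x → 4 * ∑ positions (frequent x)) +_) (∑-+ labellings _ _)) ⟩
        ∑ labellings (λ x → 4 * ∑ positions (frequent x))
          + (∑ labellings (λ x → ∑ positions (λ i → 4 * blocked x i)) + ∑ labellings (λ x → ∑ positions (λ i → 4 * violations x i)))
          ≤⟨ +-mono-≤ (∑-bound labellings ∑-frequent) (+-mono-≤ (by-position _ (∑-blocked 1≤n)) (by-position _ (∑-violations 1≤n))) ⟩
        N * M + (M * #all + M * #all)
          ≡⟨ cong (λ a → N * M + (M * a + M * a)) #all≡ ⟩
        N * M + (M * N + M * N)
          <⟨ m<m+n _ (*-mono-≤ N≥1 1≤M) ⟩
        N * M + (M * N + M * N) + N * M
          ≡⟨ four N M ⟩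
        N * (M * 4)
          ≡⟨ trans (cong (λ v → N * (v * 4)) (sym (length-allFin M))) (trans (cong (N *_) (sym (∑-const positions 4))) (sym (∑-const labellings _))) ⟩
        ∑ labellings (λ x → ∑ positions (λ _ → 4)) ∎
        where
        open ≤-Reasoning
        N = length labellings
        #all≡ : #all ≡ N
        #all≡ = trans (∑-const labellings 1) (*-identityʳ N)
        N≥1 : 1 ≤ N
        N≥1 = ≤-trans (m^n>0 n {{>-nonZero 1≤n}} M)
          (≤-reflexive (sym (trans (length-vecs vertices M) (cong (_^ M) (length-allFin n)))))
        four : ∀ a b → a * b + (b * a + b * a) + a * b ≡ a * (b * 4)
        four = solve-∀
        by-position : ∀ (f : Labelling → Fin M → ℕ) → (∀ i → 4 * ∑ labellings (λ x → f x i) ≤ #all) →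
                      ∑ labellings (λ x → ∑ positions (λ i → 4 * f x i)) ≤ M * #all
        by-position f h = begin
          ∑ labellings (λ x → ∑ positions (λ i → 4 * f x i))  ≡⟨ ∑-swap labellings positions _ ⟩
          ∑ positions (λ i → ∑ labellings (λ x → 4 * f x i))  ≡⟨ ∑-cong positions (λ i → ∑-*ˡ labellings 4 _) ⟩
          ∑ positions (λ i → 4 * ∑ labellings (λ x → f x i))  ≤⟨ ∑-bound positions h ⟩
          length positions * #all                             ≡⟨ cong (_* #all) (length-allFin M) ⟩
          M * #all                                            ∎

      contradictory : ∀ x i → ¬ (defects x i < 4)
      contradictory x i lt = overcrowded {L} {2 ^ β * 2 ^ β * 2 ^ β * 1000} {#with x i} {#avoiding x i} {#few x i} {#many x i} L-large
        (≤-trans (≮⇒≥ (ind-zero (#valid x <? L * #with x i) f₁≡0)) (≤-reflexive (#valid-split x i)))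
        (#avoiding-split x i)
        (≮⇒≥ (ind-zero (#avoiding x i <? 2 * #many x i) f₂≡0))
        (Local.few-versus-none x i cl β)
        (none≤with x i cl)
        (#avoiding≥1 x i)
        where
        zeros : frequent x i ≡ 0 × blocked x i ≡ 0 × violations x i ≡ 0
        zeros = 4*[a+b+c]<4 (frequent x i) (blocked x i) (violations x i) lt
        f₁≡0 = proj₁ zeros
        f₂≡0 = proj₁ (proj₂ zeros)
        f₃≡0 = proj₂ (proj₂ zeros)
        cl : Clean x i
        cl = clean f₃≡0

      impossible : ⊥
      impossible =
        let x , lt  = ∑-<⇒∃ labellings ∑-defects
            i , lt′ = ∑-<⇒∃ positions {defects x} {λ _ → 4} lt
        in contradictory x i lt′

module _ {n} (κ : Fin n → Fin n → ℕ) (κ-sym : ∀ u v → κ u v ≡ κ v u) (M : ℕ) where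

  open Sets κ κ-sym M
  open Core κ κ-sym M

  LargeValid : ℕ → Labelling → Positions → Set
  LargeValid r x S = Valid x S × r ≤ size S

  LargeValid? : ∀ r x S → Dec (LargeValid r x S)
  LargeValid? r x S = Valid? x S ×-dec r ≤? size S

  rainbow-or-small : ∀ {r} → 3 ≤ r → Rainbow κ r ⊎ (∀ x S → Valid x S → size S ≤ r)
  rainbow-or-small {r} 3≤r = decide (any? (λ x → any? (LargeValid? r x) subsets) labellings)
    where
    decide : Dec (Any (λ x → Any (LargeValid r x) subsets) labellings) → Rainbow κ r ⊎ (∀ x S → Valid x S → size S ≤ r)
    decide (yes found) =
      let x , found′ = satisfied found
          S , v , r≤ = satisfied found′
      in inj₁ (valid⇒rainbow x S 3≤r v r≤)
    decide (no none) = inj₂ λ x S v → ≮⇒≥ λ r< →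
      none (lose (∈-vecs ∈-allFin x) (lose (∈-vecs ∈-bools S) (v , <⇒≤ r<)))

-- Divides out `m`: the conditions on `n` depend only on the ratio `D = n / m`.
sparse⇒rainbow : ∀ {n} (κ : Fin n → Fin n → ℕ) (κ-sym : ∀ u v → κ u v ≡ κ v u)
  (m : ℕ) (degree : ∀ u k → ∑ (allFin n) (λ w → ind (κ u w ≟ k)) ≤ m) (r M L β D : ℕ) →
  3 ≤ r → 1 ≤ m → 1 ≤ D → n ≡ D * m → 1 ≤ M → 4 * (L * r) ≤ M →
  24 * (r * r * r) ≤ D * suc β →
  4 + 2 ^ β * 2 ^ β * 2 ^ β * 1000 < 4 * L →
  4 * (6 * (D * D * M ^ 2) + 18 * (D * M ^ 5) + 27 * M ^ 8) ≤ D * D * D →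
  Rainbow κ r
sparse⇒rainbow {n} κ κ-sym m degree r M L β D 3≤r 1≤m 1≤D n≡ 1≤M L-small β-large L-large D-large =
  [ id , (λ small → ⊥-elim (Core.Counting.Contradiction.impossible κ κ-sym M m degree r small L β
           (≤-trans (*-mono-≤ 1≤D 1≤m) (≤-reflexive (sym n≡))) 1≤M L-small β-large′ L-large n-large)) ]′
  (rainbow-or-small κ κ-sym M 3≤r)
  where
  open ≤-Reasoning
  β-large′ : 24 * (r * r * r) * m ≤ n * suc β
  β-large′ = begin
    24 * (r * r * r) * m  ≤⟨ *-monoˡ-≤ m β-large ⟩
    D * suc β * m         ≡⟨ exch D (suc β) m ⟩
    D * m * suc β         ≡⟨ cong (_* suc β) n≡ ⟨
    n * suc β             ∎
    where
    exch : ∀ a b c → a * b * c ≡ a * c * b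
    exch = solve-∀
  n-large : 4 * (n * n * (M ^ 2 * (3 * m + 3 * m)) + 2 * (n * (M ^ 5 * (3 * m * (3 * m))))
              + M ^ 8 * (3 * m * (3 * m) * (3 * m))) ≤ n * n * n
  n-large = subst (λ n → 4 * (n * n * (M ^ 2 * (3 * m + 3 * m)) + 2 * (n * (M ^ 5 * (3 * m * (3 * m))))
              + M ^ 8 * (3 * m * (3 * m) * (3 * m))) ≤ n * n * n) (sym n≡) (begin
    _                                                                              ≡⟨ collect D m (M ^ 2) (M ^ 5) (M ^ 8) ⟩
    4 * (6 * (D * D * M ^ 2) + 18 * (D * M ^ 5) + 27 * M ^ 8) * (m * m * m)        ≤⟨ *-monoˡ-≤ (m * m * m) D-large ⟩
    D * D * D * (m * m * m)                                                        ≡⟨ cube D m ⟩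
    D * m * (D * m) * (D * m)                                                      ∎)
    where
    collect : ∀ d m p q s → 4 * (d * m * (d * m) * (p * (3 * m + 3 * m)) + 2 * (d * m * (q * (3 * m * (3 * m)))) + s * (3 * m * (3 * m) * (3 * m)))
      ≡ 4 * (6 * (d * d * p) + 18 * (d * q) + 27 * s) * (m * m * m)
    collect = solve-∀
    cube : ∀ d m → d * d * d * (m * m * m) ≡ d * m * (d * m) * (d * m)
    cube = solve-∀

-- Passing to monochromatic neighbourhoods

Orderable : ∀ {n} → (Fin n → Fin n → ℕ) → ℕ → Set
Orderable {n} κ s = Σ (Fin s → Fin n) λ g → Injective _≡_ _≡_ g ×
  (∀ i j k → i Fin.< j → j Fin.< k → κ (g i) (g j) ≡ κ (g i) (g k))

MonoStar : ∀ {n} → (Fin n → Fin n → ℕ) → Fin n → ℕ → ℕ → Set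
MonoStar {n} κ u c m =
  Σ (Fin m → Fin n) λ ι → Injective _≡_ _≡_ ι × (∀ a → u ≢ ι a) × (∀ a → κ u (ι a) ≡ c)

-- The diagonal values `κ u u` are arbitrary, so `u` may be counted among its own neighbours. Of
-- `m + 1` choices one is discarded: `u` if it is present, the first otherwise.
neighbours : ∀ {n} (κ : Fin n → Fin n → ℕ) u c m → m < ∑ (allFin n) (λ w → ind (κ u w ≟ c)) →
  MonoStar κ u c m
neighbours {n} κ u c m lt = split (Fin.any? (λ a → g a Fin.≟ u))
  where
  S : Vec Bool n
  S = tabulate (λ w → does (κ u w ≟ c))
  ∈S⇒ : ∀ {w} → lookup S w ≡ true → κ u w ≡ c
  ∈S⇒ {w} w∈ = decidable-stable (κ u w ≟ c) λ ≢c →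
    absurd (trans (sym w∈) (trans (lookup∘tabulate _ w) (dec-false (κ u w ≟ c) ≢c)))
    where
    absurd : true ≢ false
    absurd ()
  ⇒∈S : ∀ {w} → κ u w ≡ c → lookup S w ≡ true
  ⇒∈S {w} e = trans (lookup∘tabulate _ w) (dec-true (κ u w ≟ c) e)
  chosen = choose S (suc m) (≤-trans lt (∑-mono (allFin n) (λ w → ind-mono ⇒∈S (κ u w ≟ c) (lookup S w Bool.≟ true))))
  g = proj₁ chosen
  g-inj = proj₁ (proj₂ chosen)
  g∈ = proj₂ (proj₂ chosen)
  split : Dec (∃ λ a → g a ≡ u) → MonoStar κ u c m
  split (yes (a , ga≡u)) = g ∘ punchIn a , (λ e → Fin.punchIn-injective a _ _ (g-inj e))
    , (λ b e → Fin.punchInᵢ≢i a b (g-inj (sym (trans ga≡u e)))) , λ b → ∈S⇒ (g∈ _)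
  split (no ∄) = g ∘ suc , (λ e → Fin.suc-injective (g-inj e)) , (λ b e → ∄ (suc b , sym e)) , λ b → ∈S⇒ (g∈ _)

-- The induction starts at two vertices, orderable for want of three indices, whence the 2 in
-- `2 * D ^ t` and the offset 2 in the order. A vertex with a dense colour goes to the front and
-- costs a factor `D`.
canonical : ∀ {r D} → 3 ≤ r → 1 ≤ D →
  (∀ {n} (κ : Fin n → Fin n → ℕ) → (∀ u v → κ u v ≡ κ v u) → ∀ m → 1 ≤ m → n ≡ D * m →
     (∀ u c → ∑ (allFin n) (λ w → ind (κ u w ≟ c)) ≤ m) → Rainbow κ r) →
  ∀ t {n} (κ : Fin n → Fin n → ℕ) → (∀ u v → κ u v ≡ κ v u) → n ≡ 2 * D ^ t →
  Orderable κ (2 + t) ⊎ Rainbow κ r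
canonical 3≤r 1≤D sparse zero κ κ-sym refl = inj₁ (id , (λ e → e) , λ
  { zero zero _ () _ ; zero (suc zero) zero _ () ; zero (suc zero) (suc zero) _ (s≤s ())
  ; (suc zero) zero _ () _ ; (suc zero) (suc zero) _ (s≤s ()) _ })
canonical {r} {D} 3≤r 1≤D sparse (suc t) {n} κ κ-sym n≡ =
  -- Only colours that occur at `u` are tested, which keeps the search finite; a colour absent at
  -- `u` has degree 0.
  decide (Fin.all? λ u → Fin.all? λ v → ∑ (allFin n) (λ w → ind (κ u w ≟ κ u v)) ≤? m)
  where
  m = 2 * D ^ t
  1≤m : 1 ≤ m
  1≤m = *-mono-≤ (s≤s (z≤n {1})) (m^n>0 D {{>-nonZero 1≤D}} t)
  n≡Dm : n ≡ D * m
  n≡Dm = trans n≡ (*-exchange 2 D (D ^ t))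
  from-dense : ∀ u c → m < ∑ (allFin n) (λ w → ind (κ u w ≟ c)) → Orderable κ (3 + t) ⊎ Rainbow κ r
  from-dense u c lt = combine (canonical 3≤r 1≤D sparse t (λ a b → κ (ι a) (ι b)) (λ a b → κ-sym (ι a) (ι b)) refl)
    where
    nbrs = neighbours κ u c m lt
    ι = proj₁ nbrs
    ι-inj = proj₁ (proj₂ nbrs)
    u≢ι = proj₁ (proj₂ (proj₂ nbrs))
    same = proj₂ (proj₂ (proj₂ nbrs))
    combine : Orderable (λ a b → κ (ι a) (ι b)) (2 + t) ⊎ Rainbow (λ a b → κ (ι a) (ι b)) r →
              Orderable κ (3 + t) ⊎ Rainbow κ r
    combine (inj₁ (g , g-inj , ordered)) = inj₁ (f , f-inj , f-ordered)
      where
      f : Fin (3 + t) → Fin n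
      f zero    = u
      f (suc a) = ι (g a)
      f-inj : Injective _≡_ _≡_ f
      f-inj {zero}  {zero}  _ = refl
      f-inj {zero}  {suc b} e = ⊥-elim (u≢ι (g b) e)
      f-inj {suc a} {zero}  e = ⊥-elim (u≢ι (g a) (sym e))
      f-inj {suc a} {suc b} e = cong suc (g-inj (ι-inj e))
      f-ordered : ∀ i j k → i Fin.< j → j Fin.< k → κ (f i) (f j) ≡ κ (f i) (f k)
      f-ordered zero    (suc j) (suc k) _ _ = trans (same (g j)) (sym (same (g k)))
      f-ordered (suc i) (suc j) (suc k) (s≤s i<j) (s≤s j<k) = ordered i j k i<j j<k
    combine (inj₂ (g , g-inj , rainbow)) = inj₂ (ι ∘ g , (λ e → g-inj (ι-inj e)) , rainbow)
  decide : Dec (∀ u v → ∑ (allFin n) (λ w → ind (κ u w ≟ κ u v)) ≤ m) → Orderable κ (3 + t) ⊎ Rainbow κ r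
  decide (yes bounded) = inj₂ (sparse κ κ-sym m 1≤m n≡Dm degree)
    where
    degree : ∀ u c → ∑ (allFin n) (λ w → ind (κ u w ≟ c)) ≤ m
    degree u c with Fin.any? (λ v → κ u v ≟ c)
    ... | yes (v , refl) = bounded u v
    ... | no ∄ = ≤-trans (≤-reflexive (∑-none (allFin n) (λ w → ind-no (λ e → ∄ (w , e)) (κ u w ≟ c)))) z≤n
  decide (no ¬bounded) =
    let u , ¬bounded-u = Fin.¬∀⟶∃¬ n _ (λ u → Fin.all? λ v → ∑ (allFin n) (λ w → ind (κ u w ≟ κ u v)) ≤? m) ¬bounded
        v , dense      = Fin.¬∀⟶∃¬ n _ (λ v → ∑ (allFin n) (λ w → ind (κ u w ≟ κ u v)) ≤? m) ¬bounded-u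
    in from-dense u (κ u v) (≰⇒> dense)

-- Choice of parameters

2^⌊log₂n⌋≤n : ∀ n → 1 ≤ n → 2 ^ ⌊log₂ n ⌋ ≤ n
2^⌊log₂n⌋≤n = <-rec _ λ
  { 1 _ _ → ≤-refl
  ; n@(suc (suc k)) rec _ → step n (s≤s (s≤s z≤n)) (rec (⌊n/2⌋<n (suc k)) (s≤s z≤n)) }
  where
  open ≤-Reasoning
  step : ∀ n → 2 ≤ n → 2 ^ ⌊log₂ ⌊ n /2⌋ ⌋ ≤ ⌊ n /2⌋ → 2 ^ ⌊log₂ n ⌋ ≤ n
  step n 2≤n ih = begin
    2 ^ ⌊log₂ n ⌋              ≤⟨ ^-monoʳ-≤ 2 (suc-pred-≥ ⌊log₂ n ⌋) ⟩
    2 * 2 ^ (⌊log₂ n ⌋ ∸ 1)    ≡⟨ cong (λ l → 2 * 2 ^ l) (⌊log₂⌊n/2⌋⌋≡⌊log₂n⌋∸1 n) ⟨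
    2 * 2 ^ ⌊log₂ ⌊ n /2⌋ ⌋    ≤⟨ *-monoʳ-≤ 2 ih ⟩
    2 * ⌊ n /2⌋                ≡⟨ cong (⌊ n /2⌋ +_) (+-identityʳ _) ⟩
    ⌊ n /2⌋ + ⌊ n /2⌋          ≤⟨ +-monoʳ-≤ ⌊ n /2⌋ (⌊n/2⌋≤⌈n/2⌉ n) ⟩
    ⌊ n /2⌋ + ⌈ n /2⌉          ≡⟨ ⌊n/2⌋+⌈n/2⌉≡n n ⟩
    n                          ∎
    where
    suc-pred-≥ : ∀ l → l ≤ suc (l ∸ 1)
    suc-pred-≥ zero    = z≤n
    suc-pred-≥ (suc l) = ≤-refl

suc≤2^ : ∀ h → suc h ≤ 2 ^ h
suc≤2^ zero    = ≤-refl
suc≤2^ (suc h) = begin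
  2 + h               ≤⟨ +-mono-≤ (m^n>0 2 h) (suc≤2^ h) ⟩
  2 ^ h + 2 ^ h       ≡⟨ cong (2 ^ h +_) (+-identityʳ _) ⟨
  2 * 2 ^ h           ∎
  where open ≤-Reasoning

^-distribʳ-* : ∀ o m n → (m * n) ^ o ≡ m ^ o * n ^ o
^-distribʳ-* zero    m n = refl
^-distribʳ-* (suc o) m n = trans (cong (m * n *_) (^-distribʳ-* o m n)) (*-interchange m n _ _)

module Numerics {k y r D : ℕ} (324≤k : 324 ≤ k) (1≤y : 1 ≤ y) (y²⁷≤r : y ^ 27 ≤ r)
                (large : (k * r) ^ 3 ≤ D * y) where

  M : ℕ
  M = k * r * y ^ 3

  open ≤-Reasoning

  -- Serves `b` coincidences on `3 * b` positions, one of them fixed. Multiplying by `y ^ b` turns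
  -- `D` into `D * y`; the total power of `y` is then at most `y ^ 27 ≤ r`, and together with
  -- `c ≤ k` it is absorbed as one more factor `k * r`.
  power-small : ∀ c a b → c ≤ k → 3 * a + b ≤ 27 → suc a ≡ 3 * b → c * M ^ a ≤ D ^ b
  power-small c a b c≤k exponent a≡b =
    *-cancelʳ-≤ (c * M ^ a) (D ^ b) (y ^ b) {{>-nonZero (m^n>0 y {{>-nonZero 1≤y}} b)}} (begin
      c * M ^ a * y ^ b                           ≡⟨ cong (λ p → c * p * y ^ b) (^-distribʳ-* a (k * r) (y ^ 3)) ⟩
      c * ((k * r) ^ a * (y ^ 3) ^ a) * y ^ b     ≡⟨ cong (λ p → c * ((k * r) ^ a * p) * y ^ b) (^-*-assoc y 3 a) ⟩
      c * ((k * r) ^ a * y ^ (3 * a)) * y ^ b     ≡⟨ rearrange c ((k * r) ^ a) (y ^ (3 * a)) (y ^ b) ⟩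
      c * (y ^ (3 * a) * y ^ b) * (k * r) ^ a     ≡⟨ cong (λ p → c * p * (k * r) ^ a) (^-distribˡ-+-* y (3 * a) b) ⟨
      c * y ^ (3 * a + b) * (k * r) ^ a           ≤⟨ *-monoˡ-≤ ((k * r) ^ a) (*-mono-≤ c≤k (≤-trans (^-monoʳ-≤ y {{>-nonZero 1≤y}} exponent) y²⁷≤r)) ⟩
      (k * r) ^ suc a                             ≡⟨ cong ((k * r) ^_) a≡b ⟩
      (k * r) ^ (3 * b)                           ≡⟨ ^-*-assoc (k * r) 3 b ⟨
      ((k * r) ^ 3) ^ b                           ≤⟨ ^-monoˡ-≤ b large ⟩
      (D * y) ^ b                                 ≡⟨ ^-distribʳ-* b D y ⟩
      D ^ b * y ^ b                               ∎)
    where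
    rearrange : ∀ c p q s → c * (p * q) * s ≡ c * (q * s) * p
    rearrange = solve-∀

  violations-rare : 4 * (6 * (D * D * M ^ 2) + 18 * (D * M ^ 5) + 27 * M ^ 8) ≤ D * D * D
  -- Scaled by 3 so that each of the three terms is compared with one `D * D * D`; the largest
  -- coefficient, 324, is the lower bound imposed on `k`.
  violations-rare = *-cancelˡ-≤ 3 (begin
    3 * (4 * (6 * (D * D * M ^ 2) + 18 * (D * M ^ 5) + 27 * M ^ 8))     ≡⟨ split D (M ^ 2) (M ^ 5) (M ^ 8) ⟩
    D * D * (72 * M ^ 2) + D * (216 * M ^ 5) + 324 * M ^ 8
      ≤⟨ +-mono-≤ (+-mono-≤ (*-monoʳ-≤ (D * D) (power-small 72 2 1 (≤-trans (m≤m+n 72 252) 324≤k) (m≤m+n 7 20) refl))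
                            (*-monoʳ-≤ D (power-small 216 5 2 (≤-trans (m≤m+n 216 108) 324≤k) (m≤m+n 17 10) refl)))
                  (power-small 324 8 3 324≤k ≤-refl refl) ⟩
    D * D * D ^ 1 + D * D ^ 2 + D ^ 3                                   ≡⟨ join D ⟩
    3 * (D * D * D)                                                     ∎)
    where
    split : ∀ d p q s → 3 * (4 * (6 * (d * d * p) + 18 * (d * q) + 27 * s)) ≡ d * d * (72 * p) + d * (216 * q) + 324 * s
    split = solve-∀
    join : ∀ d → d * d * (d * 1) + d * (d * (d * 1)) + d * (d * (d * 1)) ≡ 3 * (d * d * d)
    join = solve-∀

-- M ≈ r^(1 + 1/9) positions: 27 is the least exponent for which the cycles on
-- eight positions, M⁸ against D³, remain rare.
module Parameters (l r : ℕ) (324≤4l : 324 ≤ 4 * l) (3≤r : 3 ≤ r)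
                  (l-large : ∀ e → 1 ≤ e → 4 + e * e * e * 1000 < 4 * (l * (e * e * e))) where

  k h y L C D : ℕ
  k = 4 * l
  h = ⌊log₂ r ⌋ / 27
  y = 2 ^ h
  -- This is `8 ^ h` up to a constant, to outweigh the loss `1000 * 8 ^ β` at `β = h`.
  L = l * (y * y * y)
  C = (k * r) ^ 3
  -- Rounded up so that `C ≤ D * suc h`. As `suc h` is of order log r, this is r³ / log r up to a
  -- constant, and it makes sense also for `h = 0`.
  D = suc (C / suc h)

  1≤r : 1 ≤ r
  1≤r = ≤-trans (s≤s z≤n) 3≤r

  1≤y : 1 ≤ y
  1≤y = m^n>0 2 h

  y²⁷≤r : y ^ 27 ≤ r
  y²⁷≤r = begin
    y ^ 27              ≡⟨ ^-*-assoc 2 h 27 ⟩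
    2 ^ (h * 27)        ≤⟨ ^-monoʳ-≤ 2 (m/n*n≤m ⌊log₂ r ⌋ 27) ⟩
    2 ^ ⌊log₂ r ⌋       ≤⟨ 2^⌊log₂n⌋≤n r 1≤r ⟩
    r                   ∎
    where open ≤-Reasoning

  C<D*suc-h : C ≤ D * suc h
  C<D*suc-h = begin
    C                                     ≡⟨ m≡m%n+[m/n]*n C (suc h) ⟩
    C % suc h + C / suc h * suc h         ≤⟨ +-monoˡ-≤ (C / suc h * suc h) (<⇒≤ (m%n<n C (suc h))) ⟩
    D * suc h                             ∎
    where open ≤-Reasoning

  1≤k : 1 ≤ k
  1≤k = ≤-trans (m≤m+n 1 323) 324≤4l

  r≤C : r ≤ C
  r≤C = begin
    r               ≡⟨ *-identityˡ r ⟨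
    1 * r           ≤⟨ *-monoˡ-≤ r 1≤k ⟩
    k * r           ≡⟨ ^-identityʳ (k * r) ⟨
    (k * r) ^ 1     ≤⟨ ^-monoʳ-≤ (k * r) {{>-nonZero (*-mono-≤ 1≤k 1≤r)}} (m≤m+n 1 2) ⟩
    C               ∎
    where open ≤-Reasoning

  D*suc-h≤2C : D * suc h ≤ 2 * C
  D*suc-h≤2C = begin
    suc h + C / suc h * suc h     ≤⟨ +-mono-≤ suc-h≤C (m/n*n≤m C (suc h)) ⟩
    C + C                         ≡⟨ cong (C +_) (+-identityʳ C) ⟨
    2 * C                         ∎
    where
    open ≤-Reasoning
    suc-h≤C : suc h ≤ C
    suc-h≤C = begin
      suc h      ≤⟨ suc≤2^ h ⟩
      y          ≡⟨ ^-identityʳ y ⟨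
      y ^ 1      ≤⟨ ^-monoʳ-≤ y {{>-nonZero 1≤y}} (m≤m+n 1 26) ⟩
      y ^ 27     ≤⟨ y²⁷≤r ⟩
      r          ≤⟨ r≤C ⟩
      C          ∎

  open Numerics {k} {y} {r} {D} 324≤4l 1≤y y²⁷≤r (≤-trans C<D*suc-h (*-monoʳ-≤ D (suc≤2^ h)))

  1≤M : 1 ≤ M
  1≤M = *-mono-≤ (*-mono-≤ 1≤k 1≤r) (m^n>0 y {{>-nonZero 1≤y}} 3)

  L-small : 4 * (L * r) ≤ M
  L-small = ≤-reflexive (regroup l y r)
    where
    regroup : ∀ l y r → 4 * (l * (y * y * y) * r) ≡ 4 * l * r * (y * (y * (y * 1)))
    regroup = solve-∀

  h-large : 24 * (r * r * r) ≤ D * suc h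
  h-large = begin
    24 * (r * r * r)           ≤⟨ *-monoˡ-≤ (r * r * r) (≤-trans (m≤m+n 24 300) 324≤4l) ⟩
    k * (r * r * r)            ≤⟨ *-monoˡ-≤ (r * r * r) (≤-trans (≤-reflexive (sym (*-identityʳ k))) (*-monoʳ-≤ k (*-mono-≤ 1≤k 1≤k))) ⟩
    k * (k * k) * (r * r * r)  ≡⟨ regroup k r ⟩
    C                          ≤⟨ C<D*suc-h ⟩
    D * suc h                  ∎
    where
    open ≤-Reasoning
    regroup : ∀ k r → k * (k * k) * (r * r * r) ≡ k * r * (k * r * (k * r * 1))
    regroup = solve-∀

  ramsey : ∀ t {n} (κ : Fin n → Fin n → ℕ) → (∀ u v → κ u v ≡ κ v u) → n ≡ 2 * D ^ t →
           Orderable κ (2 + t) ⊎ Rainbow κ r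
  ramsey = canonical 3≤r (s≤s z≤n) λ κ κ-sym m 1≤m n≡ degree →
    sparse⇒rainbow κ κ-sym m degree r M L h D 3≤r 1≤m (s≤s z≤n) n≡ 1≤M L-small h-large (l-large y 1≤y) violations-rare

  -- The 108 is 2 · 27 · 2: the leading 2, the bound of the logarithm by `27 * suc h`, and the
  -- rounding of `D`.
  D-bound : 2 * D * ⌊log₂ r ⌋ ≤ 108 * (k * k * k) * r ^ 3
  D-bound = begin
    2 * D * ⌊log₂ r ⌋               ≤⟨ *-monoʳ-≤ (2 * D) log≤ ⟩
    2 * D * (suc h * 27)            ≡⟨ regroup D (suc h) ⟩
    54 * (D * suc h)                ≤⟨ *-monoʳ-≤ 54 D*suc-h≤2C ⟩
    54 * (2 * C)                    ≡⟨ expand k r ⟩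
    108 * (k * k * k) * r ^ 3       ∎
    where
    open ≤-Reasoning
    regroup : ∀ d s → 2 * d * (s * 27) ≡ 54 * (d * s)
    regroup = solve-∀
    expand : ∀ k r → 54 * (2 * (k * r * (k * r * (k * r * 1)))) ≡ 108 * (k * k * k) * (r * (r * (r * 1)))
    expand = solve-∀
    log≤ : ⌊log₂ r ⌋ ≤ suc h * 27
    log≤ = begin
      ⌊log₂ r ⌋                    ≡⟨ m≡m%n+[m/n]*n ⌊log₂ r ⌋ 27 ⟩
      ⌊log₂ r ⌋ % 27 + h * 27      ≤⟨ +-monoˡ-≤ (h * 27) (<⇒≤ (m%n<n ⌊log₂ r ⌋ 27)) ⟩
      suc h * 27                   ∎

col-sym : ∀ {n} (χ : Colouring n) u v → col χ u v ≡ col χ v u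
col-sym χ u v with u Fin.<? v | v Fin.<? u
... | yes u<v | yes v<u = ⊥-elim (Fin.<-asym u<v v<u)
... | yes _   | no _    = refl
... | no _    | yes _   = refl
... | no u≮v  | no v≮u with Fin.<-cmp u v
... | tri< u<v _ _  = ⊥-elim (u≮v u<v)
... | tri≈ _ refl _ = refl
... | tri> _ _ v<u  = ⊥-elim (v≮u v<u)

-- The constant is kept symbolic, since numerals of this size must not be unfolded.
theorem-for : ∀ l → 324 ≤ 4 * l → (∀ e → 1 ≤ e → 4 + e * e * e * 1000 < 4 * (l * (e * e * e))) →
  Σ ℕ λ c → 0 < c ×
    ((o r : ℕ) → 3 ≤ o → 3 ≤ r →
    Σ ℕ λ N → CR≤ o r N ×
    N * (⌊log₂ r ⌋ ^ (o ∸ 2)) ≤ (c * (r ^ 3)) ^ (o ∸ 2))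
theorem-for l 324≤4l l-large = c , 0<c , bound
  where
  c : ℕ
  c = 108 * (4 * l * (4 * l) * (4 * l))
  1≤4l : 1 ≤ 4 * l
  1≤4l = ≤-trans (m≤m+n 1 323) 324≤4l
  0<c : 0 < c
  0<c = *-mono-≤ (m≤m+n 1 107) (*-mono-≤ (*-mono-≤ 1≤4l 1≤4l) 1≤4l)
  bound : (o r : ℕ) → 3 ≤ o → 3 ≤ r → Σ ℕ λ N → CR≤ o r N × N * (⌊log₂ r ⌋ ^ (o ∸ 2)) ≤ (c * (r ^ 3)) ^ (o ∸ 2)
  bound 0 r () 3≤r
  bound 1 r (s≤s ()) 3≤r
  bound 2 r (s≤s (s≤s ())) 3≤r
  bound (suc (suc t@(suc s))) r 3≤o 3≤r = N , (N , ≤-refl , property) , size-bound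
    where
    open Parameters l r 324≤4l 3≤r l-large
    N = 2 * D ^ t
    property : CRProperty (2 + t) r N
    property χ = convert (ramsey t (col χ) (col-sym χ) refl)
      where
      convert : Orderable (col χ) (2 + t) ⊎ Rainbow (col χ) r → HasOrderable χ (2 + t) ⊎ HasRainbow χ r
      convert (inj₁ (g , g-inj , ordered)) = inj₁ ((g , g-inj) , ordered)
      convert (inj₂ (g , g-inj , rainbow)) = inj₂ ((g , g-inj) , rainbow)
    open ≤-Reasoning
    size-bound : N * ⌊log₂ r ⌋ ^ t ≤ (c * r ^ 3) ^ t
    size-bound = begin
      -- Since `t ≥ 1`, the leading 2 is absorbed into `2 ^ t`, which pairs with `D ^ t`.
      2 * D ^ t * ⌊log₂ r ⌋ ^ t          ≤⟨ *-monoˡ-≤ (⌊log₂ r ⌋ ^ t) (*-monoˡ-≤ (D ^ t) (m≤m*n 2 (2 ^ s) {{>-nonZero (m^n>0 2 s)}})) ⟩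
      2 ^ t * D ^ t * ⌊log₂ r ⌋ ^ t      ≡⟨ cong (_* ⌊log₂ r ⌋ ^ t) (^-distribʳ-* t 2 D) ⟨
      (2 * D) ^ t * ⌊log₂ r ⌋ ^ t        ≡⟨ ^-distribʳ-* t (2 * D) ⌊log₂ r ⌋ ⟨
      (2 * D * ⌊log₂ r ⌋) ^ t            ≤⟨ ^-monoˡ-≤ t D-bound ⟩
      (c * r ^ 3) ^ t                    ∎

theorem1p2 : Σ ℕ λ c → 0 < c ×
    ((o r : ℕ) → 3 ≤ o → 3 ≤ r →
    Σ ℕ λ N → CR≤ o r N ×
    N * (⌊log₂ r ⌋ ^ (o ∸ 2)) ≤ (c * (r ^ 3)) ^ (o ∸ 2))
theorem1p2 = theorem-for 252 (m≤m+n 324 684) large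
  where
  -- At `e = 1` the requirement on `l` reads `1004 < 4 * l`, so 252 is the least possible choice; in
  -- general 1008 leaves a surplus of 8 e³ over 1000 e³, which exceeds 4.
  large : ∀ e → 1 ≤ e → 4 + e * e * e * 1000 < 4 * (252 * (e * e * e))
  large e 1≤e = begin-strict
    4 + e * e * e * 1000                    <⟨ +-monoˡ-< (e * e * e * 1000) (m≤m+n 5 3) ⟩
    8 * 1 + e * e * e * 1000                ≤⟨ +-monoˡ-≤ (e * e * e * 1000) (*-monoʳ-≤ 8 (*-mono-≤ (*-mono-≤ 1≤e 1≤e) 1≤e)) ⟩
    8 * (e * e * e) + e * e * e * 1000      ≡⟨ join (e * e * e) ⟩
    4 * (252 * (e * e * e))                 ∎
    where
    open ≤-Reasoning
    join : ∀ s → 8 * s + s * 1000 ≡ 4 * (252 * s)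
    join = solve-∀
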